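{- Let $\mathscr{T}=\{a,b,c\}$ and $I=\{1,2,3\}$, and fix any $x,y,z$ with $\{x,y,z\}=\{a,b,c\}$. Up to isomorphism there are exactly seventeen binomial partial Steiner triple systems on $15$ points (that is, $(15_4\,20_3)$-configurations) that freely contain at least three graphs $K_5$ each. These are the systems of triangle perspectives $\mathrm{TP}(\xi)$ determined by the following triples $(\xi(1,2),\xi(2,3),\xi(1,3))$: $$(\rho,\rho,\rho),\ (\rho,\rho,\mathrm{id}),\ (\rho,\mathrm{id},\mathrm{id}),\ (\rho,\rho,\rho^{ -1}),\ (\rho,\rho^{ -1},\mathrm{id}),$$ $$(\sigma_x,\sigma_y,\sigma_z),\ (\sigma_x,\sigma_y,\mathrm{id}),\ (\sigma_x,\rho,\mathrm{id}),\ (\sigma_x,\sigma_y,\rho),\ (\sigma_x,\sigma_y,\rho^{ -1}),$$ $$(\sigma_x,\sigma_x,\sigma_y),\ (\sigma_x,\sigma_x,\rho),\ (\rho,\rho,\sigma_z),\ (\rho,\rho^{ -1},\sigma_z),$$ $$(\sigma_x,\sigma_x,\sigma_x),\ (\mathrm{id},\mathrm{id},\sigma_x),\ (\mathrm{id},\mathrm{id},\mathrm{id}).$$ That is, these seventeen structures are pairwise non-isomorphic $(15_4\,20_3)$-configurations, each freely containing at least three graphs $K_5$, and every $(15_4\,20_3)$-configuration that freely contains at least three graphs $K_5$ is isomorphic to one of them.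
   Context: A $(v_r\,b_k)$-configuration is a finite incidence structure with $v$ points and $b$ lines (regarded as sets of points) such that each point is on exactly $r$ lines, each line has exactly $k$ points, and two distinct points are on at most one common line. A binomial partial Steiner triple system on $15$ points is a $(15_4\,20_3)$-configuration. An isomorphism is a bijection between point sets that maps the set of lines onto the set of lines. For a set $X$ let $\wp_2(X)$ be the set of its $2$-element subsets. A configuration with point set $S$ and line set $\mathcal{L}$ freely contains the complete graph $K_X$ if $X\subset S$, for every edge $e\in\wp_2(X)$ there is a unique line $\overline{e}\in\mathcal{L}$ containing $e$, and any two edges $e_1,e_2\in\wp_2(X)$ with $\overline{e_1}\cap\overline{e_2}\neq\emptyset$ have a common vertex in $X$. It is called a graph $K_5$ when $|X|=5$; containing at least three graphs $K_5$ means that there are at least three such sets $X$. Permutations of $\mathscr{T}=\{a,b,c\}$: $\rho$ is given by $\rho(a)=b$, $\rho(b)=c$, $\rho(c)=a$; for $x\in\mathscr{T}$, $\sigma_x$ is the transposition fixing $x$ and interchanging the other two elements. $S_{\mathscr{T}}$ is the symmetric group on $\mathscr{T}$. Let $I=\{1,2,3\}$ and let $\xi\colon I\times I\to S_{\mathscr{T}}$ satisfy $\xi(i,i)=\mathrm{id}$ and $\xi(j,i)=\xi(i,j)^{ -1}$ for all $i,j\in I$ (so $\xi$ is determined by $\xi(1,2),\xi(2,3),\xi(1,3)$). The (simple) system of triangle perspectives $\mathrm{TP}(\xi)$ has the $15$ pairwise distinct points $q^a,q^b,q^c$; $a_i,b_i,c_i$ ($i\in I$); $q^{i,j}=q^{j,i}$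 ($\{i,j\}\in\wp_2(I)$), and the following lines: $L=\{q^a,q^b,q^c\}$; $A_i=\{q^a,b_i,c_i\}$, $B_i=\{q^b,a_i,c_i\}$, $C_i=\{q^c,a_i,b_i\}$ for $i\in I$; $\{q^{i,j},u_i,(\xi(i,j)(u))_j\}$ for distinct $i,j\in I$ and $u\in\mathscr{T}$; and $\{q^{1,2},q^{1,3},q^{2,3}\}$. -}

module Defs where

open import Data.Nat using (ℕ)
open import Data.Fin using (Fin)
open import Data.Fin.Patterns
open import Data.Fin.Permutation using (Permutation; _⟨$⟩ˡ_)
open import Data.Fin.Subset using (Subset; ⁅_⁆; _∪_; _∩_; _∈_; _⊆_; ∣_∣; Nonempty)
open import Data.Fin.Subset.Properties using (_∈?_)
open import Data.List using (List; []; _∷_; _++_; map; concatMap; filter; length)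
import Data.List.Membership.Propositional as List
open import Data.List.Relation.Unary.Unique.Propositional using (Unique)
open import Data.List.Relation.Binary.BagAndSetEquality using (_∼[_]_; set)
open import Data.Product using (_×_; _,_; ∃; ∃!)
open import Data.Vec using (Vec; []; _∷_; tabulate; lookup)
open import Function.Bundles using (_↔_; Inverse; mk↔ₛ′)
open import Function.Construct.Identity using (↔-id)
open import Function.Construct.Symmetry using (↔-sym)
open import Function.Definitions using (Injective)
open import Relation.Binary.PropositionalEquality using (_≡_; _≢_; refl)

-- The line set of a finite incidence structure with point set Fin v.  The
-- order of the list carries no meaning: isomorphism compares line sets up to
-- set equality, and IsConfiguration excludes repetitions.
LineSet : ℕ → Set
LineSet v = List (Subset v)

record IsConfiguration (v r b k : ℕ) (𝓛 : LineSet v) : Set where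
  field
    distinct     : Unique 𝓛
    line-count   : length 𝓛 ≡ b
    point-degree : ∀ p → length (filter (p ∈?_) 𝓛) ≡ r
    line-size    : ∀ ℓ → ℓ List.∈ 𝓛 → ∣ ℓ ∣ ≡ k
    linear       : ∀ p q → p ≢ q → ∀ ℓ m → ℓ List.∈ 𝓛 → m List.∈ 𝓛 →
                   p ∈ ℓ → q ∈ ℓ → p ∈ m → q ∈ m → ℓ ≡ m

image : ∀ {v w} → Permutation v w → Subset v → Subset w
image π X = tabulate (λ p → lookup X (π ⟨$⟩ˡ p))

infix 4 _≅_

_≅_ : ∀ {v w} → LineSet v → LineSet w → Set
_≅_ {v} {w} 𝓛 𝓜 = ∃ λ (π : Permutation v w) → map (image π) 𝓛 ∼[ set ] 𝓜

infix 4 _∈℘₂_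

_∈℘₂_ : ∀ {v} → Subset v → Subset v → Set
e ∈℘₂ X = e ⊆ X × ∣ e ∣ ≡ 2

record FreelyContains {v : ℕ} (𝓛 : LineSet v) (X : Subset v) : Set where
  field
    edge-line : ∀ e → e ∈℘₂ X → ∃! _≡_ (λ ℓ → ℓ List.∈ 𝓛 × e ⊆ ℓ)
    free      : ∀ e₁ e₂ ℓ₁ ℓ₂ → e₁ ∈℘₂ X → e₂ ∈℘₂ X →
                ℓ₁ List.∈ 𝓛 → e₁ ⊆ ℓ₁ → ℓ₂ List.∈ 𝓛 → e₂ ⊆ ℓ₂ →
                Nonempty (ℓ₁ ∩ ℓ₂) → Nonempty (e₁ ∩ e₂)

FreelyContainsAtLeast_GraphsK_ : ℕ → ℕ → ∀ {v} → LineSet v → Set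
FreelyContainsAtLeast_GraphsK_ m n {v} 𝓛 =
  ∃ λ (X : Fin m → Subset v) →
    Injective _≡_ _≡_ X × (∀ i → ∣ X i ∣ ≡ n × FreelyContains 𝓛 (X i))

data 𝒯 : Set where
  a b c : 𝒯

S𝒯 : Set
S𝒯 = 𝒯 ↔ 𝒯

open Inverse using (to; from)

idₚ : S𝒯
idₚ = ↔-id 𝒯

ρ : S𝒯
ρ = mk↔ₛ′ f g (λ { a → refl ; b → refl ; c → refl })
              (λ { a → refl ; b → refl ; c → refl })
  where
  f g : 𝒯 → 𝒯
  f a = b
  f b = c
  f c = a
  g a = c
  g b = a
  g c = b

ρ⁻¹ : S𝒯
ρ⁻¹ = ↔-sym ρ

σ : 𝒯 → S𝒯
σ x = mk↔ₛ′ (swap x) (swap x) (invol x) (invol x)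
  where
  swap : 𝒯 → 𝒯 → 𝒯
  swap a a = a
  swap a b = c
  swap a c = b
  swap b a = c
  swap b b = b
  swap b c = a
  swap c a = b
  swap c b = a
  swap c c = c

  invol : ∀ x u → swap x (swap x u) ≡ u
  invol a a = refl
  invol a b = refl
  invol a c = refl
  invol b a = refl
  invol b b = refl
  invol b c = refl
  invol c a = refl
  invol c b = refl
  invol c c = refl

data I : Set where
  i₁ i₂ i₃ : I

record PerspectiveData : Set where
  field
    ξ     : I → I → S𝒯
    ξ-id  : ∀ i u → to (ξ i i) u ≡ u
    ξ-inv : ∀ i j u → to (ξ j i) u ≡ from (ξ i j) u

-- The elements of ℘₂ I.
data Pair : Set where
  p₁₂ p₁₃ p₂₃ : Pair

data TPPoint : Set where
  q   : 𝒯 → TPPoint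
  _⟨_⟩ : 𝒯 → I → TPPoint
  q₂  : Pair → TPPoint

TPPoint↔Fin15 : TPPoint ↔ Fin 15
TPPoint↔Fin15 = mk↔ₛ′ f g f∘g g∘f
  where
  pattern 10F = Fin.suc 9F
  pattern 11F = Fin.suc 10F
  pattern 12F = Fin.suc 11F
  pattern 13F = Fin.suc 12F
  pattern 14F = Fin.suc 13F

  f : TPPoint → Fin 15
  f (q a)      = 0F
  f (q b)      = 1F
  f (q c)      = 2F
  f (a ⟨ i₁ ⟩) = 3F
  f (b ⟨ i₁ ⟩) = 4F
  f (c ⟨ i₁ ⟩) = 5F
  f (a ⟨ i₂ ⟩) = 6F
  f (b ⟨ i₂ ⟩) = 7F
  f (c ⟨ i₂ ⟩) = 8F
  f (a ⟨ i₃ ⟩) = 9F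
  f (b ⟨ i₃ ⟩) = 10F
  f (c ⟨ i₃ ⟩) = 11F
  f (q₂ p₁₂)   = 12F
  f (q₂ p₁₃)   = 13F
  f (q₂ p₂₃)   = 14F

  g : Fin 15 → TPPoint
  g 0F  = q a
  g 1F  = q b
  g 2F  = q c
  g 3F  = a ⟨ i₁ ⟩
  g 4F  = b ⟨ i₁ ⟩
  g 5F  = c ⟨ i₁ ⟩
  g 6F  = a ⟨ i₂ ⟩
  g 7F  = b ⟨ i₂ ⟩
  g 8F  = c ⟨ i₂ ⟩
  g 9F  = a ⟨ i₃ ⟩
  g 10F = b ⟨ i₃ ⟩
  g 11F = c ⟨ i₃ ⟩
  g 12F = q₂ p₁₂
  g 13F = q₂ p₁₃
  g 14F = q₂ p₂₃

  f∘g : ∀ n → f (g n) ≡ n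
  f∘g 0F  = refl
  f∘g 1F  = refl
  f∘g 2F  = refl
  f∘g 3F  = refl
  f∘g 4F  = refl
  f∘g 5F  = refl
  f∘g 6F  = refl
  f∘g 7F  = refl
  f∘g 8F  = refl
  f∘g 9F  = refl
  f∘g 10F = refl
  f∘g 11F = refl
  f∘g 12F = refl
  f∘g 13F = refl
  f∘g 14F = refl

  g∘f : ∀ p → g (f p) ≡ p
  g∘f (q a)      = refl
  g∘f (q b)      = refl
  g∘f (q c)      = refl
  g∘f (a ⟨ i₁ ⟩) = refl
  g∘f (b ⟨ i₁ ⟩) = refl
  g∘f (c ⟨ i₁ ⟩) = refl
  g∘f (a ⟨ i₂ ⟩) = refl
  g∘f (b ⟨ i₂ ⟩) = refl
  g∘f (c ⟨ i₂ ⟩) = refl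
  g∘f (a ⟨ i₃ ⟩) = refl
  g∘f (b ⟨ i₃ ⟩) = refl
  g∘f (c ⟨ i₃ ⟩) = refl
  g∘f (q₂ p₁₂)   = refl
  g∘f (q₂ p₁₃)   = refl
  g∘f (q₂ p₂₃)   = refl

⟦_,_,_⟧ : TPPoint → TPPoint → TPPoint → Subset 15
⟦ s , t , u ⟧ = pt s ∪ pt t ∪ pt u
  where
  pt : TPPoint → Subset 15
  pt p = ⁅ to TPPoint↔Fin15 p ⁆

-- The lines {q^{i,j}, u_i, (ξ(i,j)(u))_j} are listed for i < j only: since
-- ξ(j,i) = ξ(i,j)⁻¹, exchanging i and j produces the same three lines.
TP : PerspectiveData → LineSet 15
TP Ξ =
  ⟦ q a , q b , q c ⟧ ∷
  ⟦ q₂ p₁₂ , q₂ p₁₃ , q₂ p₂₃ ⟧ ∷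
  concatMap triangle (i₁ ∷ i₂ ∷ i₃ ∷ []) ++
  perspective p₁₂ i₁ i₂ ++ perspective p₁₃ i₁ i₃ ++ perspective p₂₃ i₂ i₃
  where
  open PerspectiveData Ξ

  triangle : I → LineSet 15
  triangle i = ⟦ q a , b ⟨ i ⟩ , c ⟨ i ⟩ ⟧
             ∷ ⟦ q b , a ⟨ i ⟩ , c ⟨ i ⟩ ⟧
             ∷ ⟦ q c , a ⟨ i ⟩ , b ⟨ i ⟩ ⟧
             ∷ []

  perspective : Pair → I → I → LineSet 15
  perspective e i j =
    map (λ u → ⟦ q₂ e , u ⟨ i ⟩ , to (ξ i j) u ⟨ j ⟩ ⟧) (a ∷ b ∷ c ∷ [])

Triple : Set
Triple = S𝒯 × S𝒯 × S𝒯

-- The unique ξ with (ξ(1,2), ξ(2,3), ξ(1,3)) = (α, β, γ); note the order.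
determinedBy : Triple → PerspectiveData
determinedBy (α , β , γ) = record { ξ = ξ ; ξ-id = ξ-id ; ξ-inv = ξ-inv }
  where
  ξ : I → I → S𝒯
  ξ i₁ i₁ = idₚ
  ξ i₁ i₂ = α
  ξ i₁ i₃ = γ
  ξ i₂ i₁ = ↔-sym α
  ξ i₂ i₂ = idₚ
  ξ i₂ i₃ = β
  ξ i₃ i₁ = ↔-sym γ
  ξ i₃ i₂ = ↔-sym β
  ξ i₃ i₃ = idₚ

  ξ-id : ∀ i u → to (ξ i i) u ≡ u
  ξ-id i₁ u = refl
  ξ-id i₂ u = refl
  ξ-id i₃ u = refl

  ξ-inv : ∀ i j u → to (ξ j i) u ≡ from (ξ i j) u
  ξ-inv i₁ i₁ u = refl
  ξ-inv i₁ i₂ u = refl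
  ξ-inv i₁ i₃ u = refl
  ξ-inv i₂ i₁ u = refl
  ξ-inv i₂ i₂ u = refl
  ξ-inv i₂ i₃ u = refl
  ξ-inv i₃ i₁ u = refl
  ξ-inv i₃ i₂ u = refl
  ξ-inv i₃ i₃ u = refl

triples : 𝒯 → 𝒯 → 𝒯 → Vec Triple 17
triples x y z =
  (ρ , ρ , ρ) ∷
  (ρ , ρ , idₚ) ∷
  (ρ , idₚ , idₚ) ∷
  (ρ , ρ , ρ⁻¹) ∷
  (ρ , ρ⁻¹ , idₚ) ∷
  (σ x , σ y , σ z) ∷
  (σ x , σ y , idₚ) ∷
  (σ x , ρ , idₚ) ∷
  (σ x , σ y , ρ) ∷
  (σ x , σ y , ρ⁻¹) ∷
  (σ x , σ x , σ y) ∷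
  (σ x , σ x , ρ) ∷
  (ρ , ρ , σ z) ∷
  (ρ , ρ⁻¹ , σ z) ∷
  (σ x , σ x , σ x) ∷
  (idₚ , idₚ , σ x) ∷
  (idₚ , idₚ , idₚ) ∷
  []

{-# OPTIONS --safe #-}

-- Two free K₅s X and Y of a (15₄ 20₃)-configuration meet in exactly one point p: all four lines
-- through a point of X are edges of X, the ten edges of X have the ten points outside X as third
-- points, and Y consists of p and the third points of the four edges of X at p.  Hence three free
-- K₅s meet in three points q¹², q¹³, q²³ of a line, each of them has a triangle left over, any two
-- of these triangles are in perspective from their common point, and the edges of all three
-- triangles have the same three third points qᵃ, qᵇ, qᶜ.  The fourth lines through qᵃ, qᵇ and qᶜ
-- coincide, so the configuration is a TP(ξ).  Renaming 𝒯 and I leaves eighteen of the 216 triples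
-- of permutations, and two of these are related by an isomorphism that maps the three K₅s to
-- another three.  The remaining seventeen are separated by an invariant of the graph of
-- non-collinear pairs of points.

module Submission where

open import Defs
open import Data.Nat as ℕ using (ℕ; zero; suc; _+_; _*_; _≤_; _<_; s≤s; z≤n)
import Data.Nat.Properties as ℕ
open import Data.Fin using (Fin; zero; suc)
open import Data.Fin.Patterns
import Data.Fin.Properties as Fin
open import Data.Fin.Subset
open import Data.Fin.Subset.Properties
open import Data.List as List using (List; []; _∷_; length; filter; _++_; allFin)
import Data.List.Properties as List
open import Data.List.Relation.Unary.All as All using (All; []; _∷_)
import Data.List.Relation.Unary.All.Properties as All
open import Data.List.Relation.Unary.AllPairs as AllPairs using (AllPairs; []; _∷_)
import Data.List.Relation.Unary.AllPairs.Properties as AllPairs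
open import Data.List.Relation.Unary.Any as Any using (Any; any?; here; there)
import Data.List.Relation.Unary.Any.Properties as Any
import Data.List.Membership.Propositional as List hiding (find)
open import Data.List.Membership.Propositional using (find)
import Data.List.Membership.Propositional.Properties as List
open import Data.List.Relation.Unary.Unique.Propositional using (Unique)
open import Data.List.Relation.Binary.BagAndSetEquality using (_∼[_]_; set)
import Data.List.Relation.Unary.Unique.Propositional.Properties as Unique
open import Data.Product as Product using (_×_; _,_; ∃; ∃₂; ∃!; proj₁; proj₂)
open import Data.Sum as Sum using (_⊎_; inj₁; inj₂)
import Data.Empty
open import Data.Bool using (Bool; true; false; _∧_; not; if_then_else_)
import Data.Bool.Properties as Bool
open import Algebra.Properties.CommutativeMonoid.Sum ℕ.+-0-commutativeMonoid
  using (sum; sum-permute; sum-cong-≗)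
import Data.Vec.Properties as Vec
open import Data.Vec as Vec using (Vec; []; _∷_; lookup; tabulate)
open import Data.Fin.Permutation
  using (Permutation; permutation; _⟨$⟩ˡ_; _⟨$⟩ʳ_; inverseˡ; inverseʳ; flip; _∘ₚ_; transpose)
open import Function using (_∘_; Injective; Inverse; Equivalence; mk⇔)
open import Relation.Binary using (DecidableEquality)
open import Relation.Binary.PropositionalEquality
open import Relation.Nullary
open import Relation.Nullary.Decidable

-- Finite sets and lists

-- The parameters leave no slack. No third point of an edge of X lies in X, so the four edges at a
-- point of X take up four different lines, and the degree is four: a line that meets X contains
-- exactly two of its points. Nearly every argument about several K₅s takes a line through a point
-- of one of them and asks for its second point there. The points qᵃ, qᵇ, qᶜ name the vertices of
-- all three triangles at once, by opposite sides. Renaming can therefore only conjugate the three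
-- permutations simultaneously and permute the indices. The resulting orbits are slightly too fine,
-- because a labelling depends on which three K₅s are chosen: if all three permutations fix a letter
-- x, then {qʸ, qᶻ, x₁, x₂, x₃} is a further free K₅. Every point is collinear with eight others, so
-- the graph of non-collinear pairs is regular of degree six and its degrees separate nothing; the
-- invariant therefore starts from its triangles.

infix 4 _≟ₛ_
_≟ₛ_ : ∀ {n} (X Y : Subset n) → Dec (X ≡ Y)
_≟ₛ_ = Vec.≡-dec Bool._≟_

opaque

  unique-⊆⇒length≤ : ∀ {A : Set} {xs ys : List A} → Unique ys →
                     (∀ {y} → y List.∈ ys → y List.∈ xs) → length ys ≤ length xs
  unique-⊆⇒length≤ [] _ = z≤n
  unique-⊆⇒length≤ {ys = y ∷ ys} (y∉ys ∷ ys!) ys⊆xs with List.∈-∃++ (ys⊆xs (here refl))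
  ... | as , bs , refl = subst (suc (length ys) ≤_) length-eq (s≤s (unique-⊆⇒length≤ ys! ys⊆as++bs))
    where
    ys⊆as++bs : ∀ {z} → z List.∈ ys → z List.∈ as ++ bs
    ys⊆as++bs z∈ys with Any.++⁻ as (ys⊆xs (there z∈ys))
    ... | inj₁ z∈as         = Any.++⁺ˡ z∈as
    ... | inj₂ (here refl)  = contradiction refl (All.lookup y∉ys z∈ys)
    ... | inj₂ (there z∈bs) = Any.++⁺ʳ as z∈bs

    length-eq : suc (length (as ++ bs)) ≡ length (as ++ y ∷ bs)
    length-eq = trans (cong suc (List.length-++ as)) (sym (trans (List.length-++ as) (ℕ.+-suc (length as) (length bs))))

module _ {A : Set} (_≟_ : DecidableEquality A) where

  open import Data.List.Membership.DecPropositional _≟_ using () renaming (_∈?_ to _∈ₗ?_)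

  opaque

    fresh : ∀ {xs : List A} ys → Unique xs → length ys < length xs → ∃ λ x → x List.∈ xs × x List.∉ ys
    fresh {xs} ys xs! ys<xs with any? (λ x → ¬? (x ∈ₗ? ys)) xs
    ... | yes ∃x = find ∃x
    ... | no ∄x  = contradiction (unique-⊆⇒length≤ xs! λ x∈xs →
      decidable-stable (_ ∈ₗ? ys) λ x∉ys → ∄x (List.lose x∈xs x∉ys)) (ℕ.<⇒≱ ys<xs)

    -- An element of `xs` missing from `ys` could be put in front of `ys`, giving a duplicate-free
    -- list inside `xs` that is longer than `xs`.
    unique-⊆⇒⊇ : ∀ {xs ys : List A} → Unique ys → (∀ {y} → y List.∈ ys → y List.∈ xs) →
                 length xs ≤ length ys → ∀ {x} → x List.∈ xs → x List.∈ ys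
    unique-⊆⇒⊇ {xs} {ys} ys! ys⊆xs xs≤ys {x} x∈xs with x ∈ₗ? ys
    ... | yes x∈ys = x∈ys
    ... | no  x∉ys = contradiction xs≤ys (ℕ.<⇒≱ (unique-⊆⇒length≤ (All.¬Any⇒All¬ ys x∉ys ∷ ys!)
      λ { (here refl) → x∈xs ; (there y∈ys) → ys⊆xs y∈ys }))

allPairs-lookup : ∀ {A : Set} {R : A → A → Set} {xs x y} → (∀ {x y} → R x y → R y x) →
                  AllPairs R xs → x List.∈ xs → y List.∈ xs → x ≡ y ⊎ R x y
allPairs-lookup R-sym _        (here refl) (here refl) = inj₁ refl
allPairs-lookup R-sym (Rx ∷ _) (here refl) (there y∈)  = inj₂ (All.lookup Rx y∈)
allPairs-lookup R-sym (Ry ∷ _) (there x∈)  (here refl) = inj₂ (R-sym (All.lookup Ry x∈))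
allPairs-lookup R-sym (_ ∷ R!) (there x∈)  (there y∈)  = allPairs-lookup R-sym R! x∈ y∈

-- The counting device for free K₅s: it yields one line per edge at a vertex, and one third point
-- per edge. Apartness is a relation `R` rather than inequality because edges are ordered pairs that
-- have to differ as unordered ones.
distinct-choices : ∀ {A B : Set} {R : A → A → Set} {P : A → B → Set} {xs} → AllPairs R xs →
                   (∀ {x x′ y y′} → R x x′ → P x y → P x′ y′ → y ≢ y′) →
                   All (λ x → ∃ (P x)) xs →
                   ∃ λ ys → Unique ys × length ys ≡ length xs × All (λ y → ∃ λ x → x List.∈ xs × P x y) ys
distinct-choices [] _ [] = [] , [] , refl , []
distinct-choices {xs = x ∷ xs} (Rx ∷ R!) differ ((y , Pxy) ∷ choices)
  with ys , ys! , len , Pys ← distinct-choices R! differ choices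
  = y ∷ ys
  , All.map (λ { (x′ , x′∈xs , Px′y′) → differ (All.lookup Rx x′∈xs) Pxy Px′y′ }) Pys ∷ ys!
  , cong suc len
  , (x , here refl , Pxy) ∷ All.map (λ { (x′ , x′∈xs , Px′y′) → x′ , there x′∈xs , Px′y′ }) Pys

opaque

  injective⇒surjective : ∀ {n} {f : Fin n → Fin n} → Injective _≡_ _≡_ f → ∀ y → ∃ λ x → f x ≡ y
  injective⇒surjective {n} {f} f-inj y
    with x , _ , eq ← List.∈-map⁻ f (unique-⊆⇒⊇ Fin._≟_ {allFin n} {List.map f (allFin n)}
                       (Unique.map⁺ f-inj (Unique.allFin⁺ n)) (λ {y} _ → List.∈-allFin y)
                       (ℕ.≤-reflexive (sym (List.length-map f (allFin n)))) (List.∈-allFin y))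
    = x , sym eq

pairs : ∀ {A : Set} → List A → List (A × A)
pairs []       = []
pairs (x ∷ xs) = List.map (x ,_) xs ++ pairs xs

SamePair : ∀ {A : Set} → A × A → A × A → Set
SamePair (x , y) (x′ , y′) = (x ≡ x′ × y ≡ y′) ⊎ (x ≡ y′ × y ≡ x′)

module _ {A : Set} where

  pairs⁻ : ∀ {xs} {x y : A} → Unique xs → (x , y) List.∈ pairs xs → x List.∈ xs × y List.∈ xs × x ≢ y
  pairs⁻ {z ∷ zs} (z∉zs ∷ zs!) e∈ with Any.++⁻ (List.map (z ,_) zs) e∈
  ... | inj₁ e∈map with _ , y∈zs , refl ← List.∈-map⁻ (z ,_) e∈map = here refl , there y∈zs , All.lookup z∉zs y∈zs
  ... | inj₂ e∈rest with x∈ , y∈ , x≢y ← pairs⁻ zs! e∈rest = there x∈ , there y∈ , x≢y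

  pairs-unique : ∀ {xs : List A} → Unique xs → AllPairs (λ e f → ¬ SamePair e f) (pairs xs)
  pairs-unique [] = []
  pairs-unique {x ∷ xs} (x∉xs ∷ xs!) = AllPairs.++⁺
    (AllPairs.map⁺ (AllPairs.map (λ { y≢y′ (inj₁ (_ , y≡y′)) → y≢y′ y≡y′
                                    ; y≢y′ (inj₂ (x≡y′ , y≡x)) → y≢y′ (trans y≡x x≡y′) }) xs!))
    (pairs-unique xs!)
    (All.map⁺ (All.tabulate λ _ → All.tabulate λ {e} e∈ → λ where
      (inj₁ (refl , _)) → All.lookup x∉xs (proj₁ (pairs⁻ xs! e∈)) refl
      (inj₂ (refl , _)) → All.lookup x∉xs (proj₁ (proj₂ (pairs⁻ xs! e∈))) refl))

  length-pairs : ∀ (xs ys : List A) → length xs ≡ length ys → length (pairs xs) ≡ length (pairs ys)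
  length-pairs [] [] _ = refl
  length-pairs (x ∷ xs) (y ∷ ys) eq = trans (List.length-++ (List.map (x ,_) xs)) (trans
    (cong₂ _+_ (trans (List.length-map (x ,_) xs) (trans (ℕ.suc-injective eq) (sym (List.length-map (y ,_) ys))))
               (length-pairs xs ys (ℕ.suc-injective eq)))
    (sym (List.length-++ (List.map (y ,_) ys))))

members : ∀ {n} → Subset n → List (Fin n)
members []            = []
members (inside  ∷ X) = zero ∷ List.map suc (members X)
members (outside ∷ X) = List.map suc (members X)

length-members : ∀ {n} (X : Subset n) → length (members X) ≡ ∣ X ∣
length-members []            = refl
length-members (inside  ∷ X) = cong suc (trans (List.length-map suc (members X)) (length-members X))
length-members (outside ∷ X) = trans (List.length-map suc (members X)) (length-members X)

∈-members⁺ : ∀ {n} {X : Subset n} {p} → p ∈ X → p List.∈ members X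
∈-members⁺ {X = inside  ∷ X} {zero}  _  = here refl
∈-members⁺ {X = inside  ∷ X} {suc p} p∈ = there (List.∈-map⁺ suc (∈-members⁺ (drop-there p∈)))
∈-members⁺ {X = outside ∷ X} {suc p} p∈ = List.∈-map⁺ suc (∈-members⁺ (drop-there p∈))

∈-members⁻ : ∀ {n} {X : Subset n} {p} → p List.∈ members X → p ∈ X
∈-members⁻ {X = inside ∷ X} (here refl) = Vec.here
∈-members⁻ {X = inside ∷ X} (there p∈) with _ , p∈X , refl ← List.∈-map⁻ suc p∈ = Vec.there (∈-members⁻ p∈X)
∈-members⁻ {X = outside ∷ X} p∈ with _ , p∈X , refl ← List.∈-map⁻ suc p∈ = Vec.there (∈-members⁻ p∈X)

members-unique : ∀ {n} (X : Subset n) → Unique (members X)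
members-unique []            = []
members-unique (inside  ∷ X) = All.map⁺ (All.tabulate λ _ ()) ∷ Unique.map⁺ Fin.suc-injective (members-unique X)
members-unique (outside ∷ X) = Unique.map⁺ Fin.suc-injective (members-unique X)

opaque

  cardinality : ∀ {n} {X : Subset n} {xs : List (Fin n)} → Unique xs →
                (∀ {p} → p List.∈ xs → p ∈ X) → (∀ {p} → p ∈ X → p List.∈ xs) → ∣ X ∣ ≡ length xs
  cardinality {X = X} xs! xs⊆X X⊆xs = trans (sym (length-members X)) (ℕ.≤-antisym
    (unique-⊆⇒length≤ (members-unique X) (X⊆xs ∘ ∈-members⁻))
    (unique-⊆⇒length≤ xs! (∈-members⁺ ∘ xs⊆X)))

  exhausts : ∀ {n} {X : Subset n} {xs : List (Fin n)} → Unique xs →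
             (∀ {p} → p List.∈ xs → p ∈ X) → ∣ X ∣ ≤ length xs → ∀ {p} → p ∈ X → p List.∈ xs
  exhausts {X = X} {xs} xs! xs⊆X ∣X∣≤ = unique-⊆⇒⊇ Fin._≟_ xs! (∈-members⁺ ∘ xs⊆X)
    (subst (_≤ length xs) (sym (length-members X)) ∣X∣≤) ∘ ∈-members⁺

  another-member : ∀ {n} {X : Subset n} (xs : List (Fin n)) → length xs < ∣ X ∣ → ∃ λ p → p ∈ X × p List.∉ xs
  another-member {X = X} xs xs<X
    with p , p∈ , p∉ ← fresh Fin._≟_ xs (members-unique X) (subst (length xs <_) (sym (length-members X)) xs<X)
    = p , ∈-members⁻ p∈ , p∉

⊆∧∣≥∣⇒≡ : ∀ {n} {X Y : Subset n} → X ⊆ Y → ∣ Y ∣ ≤ ∣ X ∣ → X ≡ Y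
⊆∧∣≥∣⇒≡ {X = X} {Y} X⊆Y Y≤X = ⊆-antisym X⊆Y
  (∈-members⁻ ∘ exhausts (members-unique X) (X⊆Y ∘ ∈-members⁻) (subst (∣ Y ∣ ≤_) (sym (length-members X)) Y≤X))

infix 6 _∙∙_
_∙∙_ : ∀ {n} → Fin n → Fin n → Subset n
p ∙∙ r = ⁅ p ⁆ ∪ ⁅ r ⁆

module _ {n} {p r : Fin n} where

  ∈-∙∙⁻ : ∀ {x} → x ∈ p ∙∙ r → x ≡ p ⊎ x ≡ r
  ∈-∙∙⁻ = Sum.map (x∈⁅y⁆⇒x≡y p) (x∈⁅y⁆⇒x≡y r) ∘ x∈p∪q⁻ ⁅ p ⁆ ⁅ r ⁆

  ∈-∙∙ˡ : p ∈ p ∙∙ r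
  ∈-∙∙ˡ = x∈p∪q⁺ (inj₁ (x∈⁅x⁆ p))

  ∈-∙∙ʳ : r ∈ p ∙∙ r
  ∈-∙∙ʳ = x∈p∪q⁺ (inj₂ (x∈⁅x⁆ r))

  ∙∙-⊆ : ∀ {X} → p ∈ X → r ∈ X → p ∙∙ r ⊆ X
  ∙∙-⊆ p∈X r∈X x∈ with ∈-∙∙⁻ x∈
  ... | inj₁ refl = p∈X
  ... | inj₂ refl = r∈X

  ∣∙∙∣ : p ≢ r → ∣ p ∙∙ r ∣ ≡ 2
  ∣∙∙∣ p≢r = cardinality {xs = p ∷ r ∷ []} ((p≢r ∷ []) ∷ [] ∷ [])
    (λ { (here refl) → ∈-∙∙ˡ ; (there (here refl)) → ∈-∙∙ʳ })
    (λ x∈ → Sum.[ here , there ∘ here ]′ (∈-∙∙⁻ x∈))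

-- Lines and free K₅s

open IsConfiguration
open FreelyContains

-- A line presented by named points in a chosen order, so that arguments can speak of third points
-- instead of subsets. That these are all the points of the carrier comes from line size 3
-- (`on-line`).
record Line {v} (𝓛 : LineSet v) (p r s : Fin v) : Set where
  field
    p≢r : p ≢ r
    r≢s : r ≢ s
    p≢s : p ≢ s
    carrier : Subset v
    carrier∈ : carrier List.∈ 𝓛
    p∈ : p ∈ carrier
    r∈ : r ∈ carrier
    s∈ : s ∈ carrier

open Line

K₅ : ∀ {v} → LineSet v → Subset v → Set
K₅ 𝓛 X = ∣ X ∣ ≡ 5 × FreelyContains 𝓛 X

module _ {v} {𝓛 : LineSet v} where

  swap : ∀ {p r s} → Line 𝓛 p r s → Line 𝓛 r p s
  swap L = record
    { p≢r = p≢r L ∘ sym ; r≢s = p≢s L ; p≢s = r≢s L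
    ; carrier = carrier L ; carrier∈ = carrier∈ L ; p∈ = r∈ L ; r∈ = p∈ L ; s∈ = s∈ L }

  rotate : ∀ {p r s} → Line 𝓛 p r s → Line 𝓛 r s p
  rotate L = record
    { p≢r = r≢s L ; r≢s = p≢s L ∘ sym ; p≢s = p≢r L ∘ sym
    ; carrier = carrier L ; carrier∈ = carrier∈ L ; p∈ = r∈ L ; r∈ = s∈ L ; s∈ = p∈ L }

  swap′ : ∀ {p r s} → Line 𝓛 p r s → Line 𝓛 p s r
  swap′ = swap ∘ rotate ∘ rotate

  K₅-common-vertex : ∀ {X p r p′ r′ ℓ m x} → K₅ 𝓛 X → p ∈ X → r ∈ X → p ≢ r → p′ ∈ X → r′ ∈ X → p′ ≢ r′ →
                     ℓ List.∈ 𝓛 → p ∈ ℓ → r ∈ ℓ → m List.∈ 𝓛 → p′ ∈ m → r′ ∈ m → x ∈ ℓ → x ∈ m →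
                     (p ≡ p′ ⊎ p ≡ r′) ⊎ (r ≡ p′ ⊎ r ≡ r′)
  K₅-common-vertex {p = p} {r} {p′} {r′} (_ , F) p∈X r∈X p≢r p′∈X r′∈X p′≢r′ ℓ∈ p∈ℓ r∈ℓ m∈ p′∈m r′∈m x∈ℓ x∈m
    with y , y∈ ← free F (p ∙∙ r) (p′ ∙∙ r′) _ _ (∙∙-⊆ p∈X r∈X , ∣∙∙∣ p≢r) (∙∙-⊆ p′∈X r′∈X , ∣∙∙∣ p′≢r′)
                    ℓ∈ (∙∙-⊆ p∈ℓ r∈ℓ) m∈ (∙∙-⊆ p′∈m r′∈m) (_ , x∈p∩q⁺ (x∈ℓ , x∈m))
    with y∈₁ , y∈₂ ← x∈p∩q⁻ (p ∙∙ r) (p′ ∙∙ r′) y∈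
    with ∈-∙∙⁻ y∈₁ | ∈-∙∙⁻ y∈₂
  ... | inj₁ refl | y≡ = inj₁ y≡
  ... | inj₂ refl | y≡ = inj₂ y≡

  -- Since `X` has five points, it has a vertex `z` other than `p`, `r`, `s`. If `s` were a vertex
  -- too, the lines of the disjoint edges {r, s} and {p, z} would meet in `p`.
  third∉K₅ : ∀ {X p r s} → K₅ 𝓛 X → Line 𝓛 p r s → p ∈ X → r ∈ X → s ∉ X
  third∉K₅ {X} {p} {r} {s} K L p∈X r∈X s∈X
    with z , z∈X , z∉ ← another-member {X = X} (p ∷ r ∷ s ∷ [])
           (subst (3 <_) (sym (proj₁ K)) (s≤s (s≤s (s≤s (s≤s z≤n)))))
    with ℓ , (ℓ∈ , e⊆ℓ) , _ ← edge-line (proj₂ K) (p ∙∙ z) (∙∙-⊆ p∈X z∈X , ∣∙∙∣ (λ p≡z → z∉ (here (sym p≡z))))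
    with K₅-common-vertex K r∈X s∈X (r≢s L) p∈X z∈X (λ p≡z → z∉ (here (sym p≡z)))
           (carrier∈ L) (r∈ L) (s∈ L) ℓ∈ (e⊆ℓ ∈-∙∙ˡ) (e⊆ℓ ∈-∙∙ʳ) (p∈ L) (e⊆ℓ ∈-∙∙ˡ)
  ... | inj₁ (inj₁ r≡p) = p≢r L (sym r≡p)
  ... | inj₁ (inj₂ r≡z) = z∉ (there (here (sym r≡z)))
  ... | inj₂ (inj₁ s≡p) = p≢s L (sym s≡p)
  ... | inj₂ (inj₂ s≡z) = z∉ (there (there (here (sym s≡z))))

  module _ {d l} (cfg : IsConfiguration v d l 3 𝓛) where

    opaque

      complete-line : ∀ {ℓ p r} → ℓ List.∈ 𝓛 → p ∈ ℓ → r ∈ ℓ → p ≢ r →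
                      ∃ λ s → ∃ λ (L : Line 𝓛 p r s) → carrier L ≡ ℓ
      complete-line {ℓ} {p} {r} ℓ∈ p∈ℓ r∈ℓ p≢r
        with s , s∈ℓ , s∉ ← another-member {X = ℓ} (p ∷ r ∷ [])
               (subst (2 <_) (sym (line-size cfg ℓ ℓ∈)) (s≤s (s≤s (s≤s z≤n))))
        = s , record { p≢r = p≢r ; r≢s = λ r≡s → s∉ (there (here (sym r≡s))) ; p≢s = λ p≡s → s∉ (here (sym p≡s))
                     ; carrier∈ = ℓ∈ ; p∈ = p∈ℓ ; r∈ = r∈ℓ ; s∈ = s∈ℓ } , refl

      on-line : ∀ {p r s x} (L : Line 𝓛 p r s) → x ∈ carrier L → x List.∈ p ∷ r ∷ s ∷ []
      on-line L = exhausts ((p≢r L ∷ p≢s L ∷ []) ∷ (r≢s L ∷ []) ∷ [] ∷ [])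
        (λ { (here refl) → p∈ L ; (there (here refl)) → r∈ L ; (there (there (here refl))) → s∈ L })
        (ℕ.≤-reflexive (line-size cfg _ (carrier∈ L)))

    carrier-unique : ∀ {p r s ℓ} (L : Line 𝓛 p r s) → ℓ List.∈ 𝓛 → p ∈ ℓ → r ∈ ℓ → ℓ ≡ carrier L
    carrier-unique L ℓ∈ p∈ℓ r∈ℓ = linear cfg _ _ (p≢r L) _ _ ℓ∈ (carrier∈ L) p∈ℓ r∈ℓ (p∈ L) (r∈ L)

    opaque

      third-unique : ∀ {p r s s′} → Line 𝓛 p r s → Line 𝓛 p r s′ → s ≡ s′
      third-unique L M with on-line M (subst (_ ∈_) (carrier-unique M (carrier∈ L) (p∈ L) (r∈ L)) (s∈ L))
      ... | here s≡p                 = contradiction (sym s≡p) (p≢s L)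
      ... | there (here s≡r)         = contradiction (sym s≡r) (r≢s L)
      ... | there (there (here s≡t)) = s≡t

    module _ {X} (K : K₅ 𝓛 X) where

      opaque

        K₅-edge-line : ∀ {p r} → p ∈ X → r ∈ X → p ≢ r → ∃ λ s → Line 𝓛 p r s
        K₅-edge-line {p} {r} p∈X r∈X p≢r
          with ℓ , (ℓ∈ , e⊆ℓ) , _ ← edge-line (proj₂ K) (p ∙∙ r) (∙∙-⊆ p∈X r∈X , ∣∙∙∣ p≢r)
          = Product.map₂ proj₁ (complete-line ℓ∈ (e⊆ℓ ∈-∙∙ˡ) (e⊆ℓ ∈-∙∙ʳ) p≢r)

      -- By freeness the two edges share a vertex. This vertex and `s` are on one line only, which
      -- fixes the other ends.
      K₅-edge-unique : ∀ {p r p′ r′ s} → p ∈ X → r ∈ X → p′ ∈ X → r′ ∈ X →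
                       Line 𝓛 p r s → Line 𝓛 p′ r′ s → SamePair (p , r) (p′ , r′)
      K₅-edge-unique p∈X r∈X p′∈X r′∈X L L′
        with K₅-common-vertex K p∈X r∈X (p≢r L) p′∈X r′∈X (p≢r L′)
               (carrier∈ L) (p∈ L) (r∈ L) (carrier∈ L′) (p∈ L′) (r∈ L′) (s∈ L) (s∈ L′)
      ... | inj₁ (inj₁ refl) = inj₁ (refl , third-unique (swap′ L) (swap′ L′))
      ... | inj₁ (inj₂ refl) = inj₂ (refl , third-unique (swap′ L) (rotate L′))
      ... | inj₂ (inj₁ refl) = inj₂ (third-unique (rotate L) (swap′ L′) , refl)
      ... | inj₂ (inj₂ refl) = inj₁ (third-unique (rotate L) (rotate L′) , refl)

-- Counting around free K₅s in a (15₄ 20₃)-configuration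

module _ {𝓛 : LineSet 15} (cfg : IsConfiguration 15 4 20 3 𝓛) where

  module _ {X} (K : K₅ 𝓛 X) where

    opaque

      -- All four lines through p are accounted for by the four edges of X at p.
      K₅-meets-line : ∀ {p s t} → p ∈ X → Line 𝓛 p s t → s ∈ X ⊎ t ∈ X
      K₅-meets-line {p} {s} {t} p∈X L with s ∈? X | t ∈? X
      ... | yes s∈X | _       = inj₁ s∈X
      ... | no  _   | yes t∈X = inj₂ t∈X
      ... | no  s∉X | no  t∉X = contradiction (too-many-lines edge-lines) (ℕ.<-irrefl refl)
        where
        neighbours : List (Fin 15)
        neighbours = filter (λ w → ¬? (p Fin.≟ w)) (members X)

        X⊆ : ∀ {w} → w List.∈ members X → w List.∈ p ∷ neighbours
        X⊆ {w} w∈ with p Fin.≟ w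
        ... | yes refl = here refl
        ... | no  p≢w  = there (List.∈-filter⁺ _ w∈ p≢w)

        EdgeLine : Fin 15 → Subset 15 → Set
        EdgeLine w m = w ∈ X × ∃ λ u → ∃ λ (M : Line 𝓛 p w u) → carrier M ≡ m

        edge-line-of : ∀ {w} → w List.∈ neighbours → ∃ (EdgeLine w)
        edge-line-of w∈ with w∈X , p≢w ← List.∈-filter⁻ _ w∈
          with u , M ← K₅-edge-line cfg K p∈X (∈-members⁻ w∈X) p≢w
          = carrier M , ∈-members⁻ w∈X , u , M , refl

        -- A line shared by two edges at `p` would have its third point in `X`.
        different : ∀ {w w′ m m′} → w ≢ w′ → EdgeLine w m → EdgeLine w′ m′ → m ≢ m′
        different w≢w′ (w∈X , _ , M , refl) (w′∈X , _ , M′ , M′≡M) refl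
          with on-line cfg M (subst (_ ∈_) M′≡M (r∈ M′))
        ... | here w′≡p                  = p≢r M′ (sym w′≡p)
        ... | there (here w′≡w)          = w≢w′ (sym w′≡w)
        ... | there (there (here refl))  = third∉K₅ K M p∈X w∈X w′∈X

        EdgeLines : Set
        EdgeLines = ∃ λ ms → Unique ms × length ms ≡ length neighbours ×
                    All (λ m → ∃ λ w → w List.∈ neighbours × EdgeLine w m) ms

        edge-lines : EdgeLines
        edge-lines = distinct-choices (Unique.filter⁺ (λ w → ¬? (p Fin.≟ w)) (members-unique X)) different
          (All.tabulate edge-line-of)

        too-many-lines : EdgeLines → 4 < 4
        too-many-lines (ms , ms! , length-ms , edges) = begin-strict
          4                               <⟨ ℕ.≤-refl ⟩
          5                               ≡⟨ trans (length-members X) (proj₁ K) ⟨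
          length (members X)              ≤⟨ unique-⊆⇒length≤ (members-unique X) X⊆ ⟩
          suc (length neighbours)         ≡⟨ cong suc length-ms ⟨
          -- Neither `s` nor `t` is in `X`, so `L` is a fifth line through `p` next to the four edge
          -- lines.
          length (carrier L ∷ ms)         ≤⟨ unique-⊆⇒length≤ (All.tabulate ℓ∉ms ∷ ms!) ⊆pencil ⟩
          length (filter (p ∈?_) 𝓛)       ≡⟨ point-degree cfg p ⟩
          4                               ∎
          where
          open ℕ.≤-Reasoning

          ℓ∉ms : ∀ {m} → m List.∈ ms → carrier L ≢ m
          ℓ∉ms m∈ refl with _ , _ , w∈X , _ , M , M≡ ← All.lookup edges m∈
            with on-line cfg L (subst (_ ∈_) M≡ (r∈ M))
          ... | here w≡p                  = p≢r M (sym w≡p)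
          ... | there (here refl)         = s∉X w∈X
          ... | there (there (here refl)) = t∉X w∈X

          ⊆pencil : ∀ {m} → m List.∈ carrier L ∷ ms → m List.∈ filter (p ∈?_) 𝓛
          ⊆pencil (here refl) = List.∈-filter⁺ (p ∈?_) (carrier∈ L) (p∈ L)
          ⊆pencil (there m∈) with _ , _ , _ , _ , M , refl ← All.lookup edges m∈ =
            List.∈-filter⁺ (p ∈?_) (carrier∈ M) (p∈ M)

    opaque

      -- The ten edges of X have distinct third points, so these are all ten points outside X.
      K₅-third-points : ∀ {s} → s ∉ X → ∃₂ λ p r → p ∈ X × r ∈ X × Line 𝓛 p r s
      K₅-third-points {s} s∉X = find-edge thirds
        where
        Edge : Fin 15 × Fin 15 → Fin 15 → Set
        Edge (p , r) t = p ∈ X × r ∈ X × Line 𝓛 p r t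

        different : ∀ {e e′ t t′} → ¬ SamePair e e′ → Edge e t → Edge e′ t′ → t ≢ t′
        different e≢e′ (p∈X , r∈X , L) (p′∈X , r′∈X , L′) refl =
          e≢e′ (K₅-edge-unique cfg K p∈X r∈X p′∈X r′∈X L L′)

        third : ∀ {e} → e List.∈ pairs (members X) → ∃ (Edge e)
        third e∈ with p∈X , r∈X , p≢r ← pairs⁻ (members-unique X) e∈
          with t , L ← K₅-edge-line cfg K (∈-members⁻ p∈X) (∈-members⁻ r∈X) p≢r
          = t , ∈-members⁻ p∈X , ∈-members⁻ r∈X , L

        Thirds : Set
        Thirds = ∃ λ ts → Unique ts × length ts ≡ length (pairs (members X)) ×
                 All (λ t → ∃ λ e → e List.∈ pairs (members X) × Edge e t) ts

        thirds : Thirds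
        thirds = distinct-choices (pairs-unique (members-unique X)) different (All.tabulate third)

        find-edge : Thirds → ∃₂ λ p r → p ∈ X × r ∈ X × Line 𝓛 p r s
        find-edge (ts , ts! , length-ts , edges) =
          from-members-or-thirds (List.∈-++⁻ (members X) (everything (List.∈-allFin s)))
          where
          length-X : length (members X) ≡ 5
          length-X = trans (length-members X) (proj₁ K)

          length-all : length (members X ++ ts) ≡ 15
          length-all = trans (List.length-++ (members X)) (cong₂ _+_ length-X
            -- `List.replicate 5 s` stands for any list of length five: it makes the number of pairs
            -- evaluate to ten.
            (trans length-ts (length-pairs (members X) (List.replicate 5 s) length-X)))

          disjoint : ∀ {t} → t List.∈ members X × t List.∈ ts → Data.Empty.⊥
          disjoint (t∈X , t∈ts) with _ , _ , p∈X , r∈X , L ← All.lookup edges t∈ts =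
            third∉K₅ K L p∈X r∈X (∈-members⁻ t∈X)

          everything : ∀ {t} → t List.∈ allFin 15 → t List.∈ members X ++ ts
          everything = unique-⊆⇒⊇ Fin._≟_ (Unique.++⁺ (members-unique X) ts! disjoint)
            (λ {y} _ → List.∈-allFin y)
            (ℕ.≤-reflexive (sym length-all))

          from-members-or-thirds : s List.∈ members X ⊎ s List.∈ ts → ∃₂ λ p r → p ∈ X × r ∈ X × Line 𝓛 p r s
          from-members-or-thirds (inj₁ s∈X)  = contradiction (∈-members⁻ s∈X) s∉X
          from-members-or-thirds (inj₂ s∈ts) with (p , r) , _ , edge ← All.lookup edges s∈ts = p , r , edge

  module _ {X Y} (KX : K₅ 𝓛 X) (KY : K₅ 𝓛 Y) where

    opaque

      -- A point of `Y` outside `X` is the third point of an edge of `X`. Its line has a second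
      -- point in `Y`, which is an end of that edge.
      K₅s-meet : ∃ λ p → p ∈ X × p ∈ Y
      K₅s-meet with r , r∈Y , _ ← another-member {X = Y} [] (subst (0 <_) (sym (proj₁ KY)) (s≤s z≤n)) with r ∈? X
      ... | yes r∈X = r , r∈X , r∈Y
      ... | no  r∉X with p , p′ , p∈X , p′∈X , L ← K₅-third-points KX r∉X
                    with K₅-meets-line KY r∈Y (rotate (rotate L))
      ...   | inj₁ p∈Y  = p , p∈X , p∈Y
      ...   | inj₂ p′∈Y = p′ , p′∈X , p′∈Y

    -- The line joining `r` to `p` has a second point in `X`. Thus `r` becomes the third point of an
    -- edge of `X`, and the uniqueness of such edges applies to points of `Y`.
    K₅s-cross : ∀ {p r} → p ∈ X → p ∈ Y → r ∈ Y → r ∉ X → ∃ λ s → Line 𝓛 r p s × s ∈ X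
    K₅s-cross p∈X p∈Y r∈Y r∉X
      with s , L ← K₅-edge-line cfg KY r∈Y p∈Y (λ { refl → r∉X p∈X })
      with K₅-meets-line KX p∈X (swap L)
    ... | inj₁ r∈X = contradiction r∈X r∉X
    ... | inj₂ s∈X = s , L , s∈X

    opaque

      -- Joining a point `r` of `Y` outside `X` to two common points gives two edges of `X` with
      -- third point `r`. They are the same edge, so either the common points agree or one of them
      -- is the third point of an edge of `Y`.
      K₅s-meet-once : X ≢ Y → ∀ {p p′} → p ∈ X → p ∈ Y → p′ ∈ X → p′ ∈ Y → p ≡ p′
      K₅s-meet-once X≢Y {p} {p′} p∈X p∈Y p′∈X p′∈Y with p Fin.≟ p′
      ... | yes p≡p′ = p≡p′
      ... | no  p≢p′ with any? (λ r → ¬? (r ∈? X)) (members Y)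
      ...   | no Y⊆X = contradiction
        (sym (⊆∧∣≥∣⇒≡ (λ {r} r∈Y → decidable-stable (r ∈? X) λ r∉X → Y⊆X (List.lose (∈-members⁺ r∈Y) r∉X))
          (ℕ.≤-reflexive (trans (proj₁ KX) (sym (proj₁ KY)))))) X≢Y
      ...   | yes ∃r with r , r∈ , r∉X ← find ∃r
                     with s , L , s∈X ← K₅s-cross p∈X p∈Y (∈-members⁻ r∈) r∉X
                        | s′ , L′ , s′∈X ← K₅s-cross p′∈X p′∈Y (∈-members⁻ r∈) r∉X
                     with K₅-edge-unique cfg KX p∈X s∈X p′∈X s′∈X (rotate L) (rotate L′)
      ...     | inj₁ (p≡p′ , _) = p≡p′
      ...     | inj₂ (_ , refl) = contradiction p′∈Y (third∉K₅ KY L (∈-members⁻ r∈) p∈Y)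

  opaque

    -- The line of an edge {p, y} of `Y` has a second point in `X` and one in `Z`. Neither can be
    -- `y`, so its third point lies in both, and `X` and `Z` meet twice.
    K₅s-not-concurrent : ∀ {X Y Z p} → K₅ 𝓛 X → K₅ 𝓛 Y → K₅ 𝓛 Z → X ≢ Y → Y ≢ Z → X ≢ Z →
                         p ∈ X → p ∈ Y → p ∉ Z
    K₅s-not-concurrent {X} {Y} {Z} {p} KX KY KZ X≢Y Y≢Z X≢Z p∈X p∈Y p∈Z
      with y , y∈Y , y∉[p] ← another-member {X = Y} (p ∷ []) (subst (1 <_) (sym (proj₁ KY)) (s≤s (s≤s z≤n)))
      with s , L ← K₅-edge-line cfg KY p∈Y y∈Y (λ p≡y → y∉[p] (here (sym p≡y)))
      with K₅-meets-line KX p∈X L | K₅-meets-line KZ p∈Z L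
    ... | inj₁ y∈X | _        = y∉[p] (here (K₅s-meet-once KX KY X≢Y y∈X y∈Y p∈X p∈Y))
    ... | inj₂ _   | inj₁ y∈Z = y∉[p] (here (K₅s-meet-once KY KZ Y≢Z y∈Y y∈Z p∈Y p∈Z))
    ... | inj₂ s∈X | inj₂ s∈Z = p≢s L (K₅s-meet-once KX KZ X≢Z p∈X p∈Z s∈X s∈Z)

-- Finite decision procedures and permutations of 𝒯 and I

open Inverse using (to; from)

decide : ∀ {P : Set} (P? : Dec P) {_ : True P?} → P
decide P? {t} = toWitness t

record Finite (A : Set) : Set where
  field
    elements : List A
    complete : ∀ x → x List.∈ elements

record Discrete (A : Set) : Set where
  infix 4 _≟_
  field
    _≟_ : DecidableEquality A

open Finite {{...}}
open Discrete {{...}}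

module _ {A : Set} {{_ : Finite A}} {P : A → Set} (P? : ∀ x → Dec (P x)) where

  dec-∀ : Dec (∀ x → P x)
  dec-∀ = map′ (λ ps x → All.lookup ps (complete x)) (λ p → All.tabulate λ {x} _ → p x) (All.all? P? elements)

  dec-∃ : Dec (∃ P)
  dec-∃ = map′ Any.satisfied (λ (x , px) → Any.map (λ { refl → px }) (complete x)) (any? P? elements)

instance
  finite-𝒯 : Finite 𝒯
  finite-𝒯 = record
    { elements = a ∷ b ∷ c ∷ []
    ; complete = λ { a → here refl ; b → there (here refl) ; c → there (there (here refl)) }
    }

  discrete-𝒯 : Discrete 𝒯
  discrete-𝒯 = record
    { _≟_ = λ { a a → yes refl ; a b → no λ () ; a c → no λ ()
              ; b a → no λ () ; b b → yes refl ; b c → no λ ()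
              ; c a → no λ () ; c b → no λ () ; c c → yes refl } }

index : 𝒯 → I
index a = i₁
index b = i₂
index c = i₃

index⁻¹ : I → 𝒯
index⁻¹ i₁ = a
index⁻¹ i₂ = b
index⁻¹ i₃ = c

index∘index⁻¹ : ∀ i → index (index⁻¹ i) ≡ i
index∘index⁻¹ i₁ = refl
index∘index⁻¹ i₂ = refl
index∘index⁻¹ i₃ = refl

index⁻¹∘index : ∀ u → index⁻¹ (index u) ≡ u
index⁻¹∘index a = refl
index⁻¹∘index b = refl
index⁻¹∘index c = refl

-- The side of the triangle I opposite to a vertex.
side : I → Pair
side i₁ = p₂₃
side i₂ = p₁₃
side i₃ = p₁₂

side⁻¹ : Pair → I
side⁻¹ p₂₃ = i₁
side⁻¹ p₁₃ = i₂
side⁻¹ p₁₂ = i₃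

side∘side⁻¹ : ∀ e → side (side⁻¹ e) ≡ e
side∘side⁻¹ p₁₂ = refl
side∘side⁻¹ p₁₃ = refl
side∘side⁻¹ p₂₃ = refl

side⁻¹∘side : ∀ i → side⁻¹ (side i) ≡ i
side⁻¹∘side i₁ = refl
side⁻¹∘side i₂ = refl
side⁻¹∘side i₃ = refl

module _ {A B : Set} (f : A → B) (f⁻¹ : B → A) (f∘f⁻¹ : ∀ y → f (f⁻¹ y) ≡ y) where

  finite-image : {{Finite A}} → Finite B
  finite-image = record
    { elements = List.map f elements
    ; complete = λ y → subst (List._∈ List.map f elements) (f∘f⁻¹ y) (List.∈-map⁺ f (complete (f⁻¹ y)))
    }

  discrete-image : {{Discrete A}} → Discrete B
  discrete-image = record
    { _≟_ = λ y y′ → map′ (λ eq → trans (sym (f∘f⁻¹ y)) (trans (cong f eq) (f∘f⁻¹ y′))) (cong f⁻¹)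
                          (f⁻¹ y ≟ f⁻¹ y′)
    }

instance
  finite-I : Finite I
  finite-I = finite-image index index⁻¹ index∘index⁻¹

  discrete-I : Discrete I
  discrete-I = discrete-image index index⁻¹ index∘index⁻¹

  finite-Pair : Finite Pair
  finite-Pair = finite-image side side⁻¹ side∘side⁻¹

  discrete-Pair : Discrete Pair
  discrete-Pair = discrete-image side side⁻¹ side∘side⁻¹

module _ {A : Set} where

  Distinct : A → A → A → Set
  Distinct x y z = x ≢ y × y ≢ z × x ≢ z

  module _ {{_ : Discrete A}} where

    distinct? : ∀ x y z → Dec (Distinct x y z)
    distinct? x y z = ¬? (x ≟ y) ×-dec ¬? (y ≟ z) ×-dec ¬? (x ≟ z)

    samePair? : ∀ e f → Dec (SamePair {A = A} e f)
    samePair? (x , y) (x′ , y′) = (x ≟ x′ ×-dec y ≟ y′) ⊎-dec (x ≟ y′ ×-dec y ≟ x′)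

opaque

  distinct-from-two : ∀ (v w : 𝒯) → v ≢ w → ∃ λ u → Distinct u v w
  distinct-from-two = decide (dec-∀ λ v → dec-∀ λ w → ¬? (v ≟ w) →-dec dec-∃ λ u → distinct? u v w)

  distinct-from-one : ∀ (u : 𝒯) → ∃₂ λ v w → Distinct u v w
  distinct-from-one = decide (dec-∀ λ u → dec-∃ λ v → dec-∃ λ w → distinct? u v w)

  complement-unique : ∀ (u v w v′ w′ : 𝒯) → Distinct u v w → Distinct u v′ w′ → SamePair (v , w) (v′ , w′)
  complement-unique = decide (dec-∀ λ u → dec-∀ λ v → dec-∀ λ w → dec-∀ λ v′ → dec-∀ λ w′ →
    distinct? u v w →-dec (distinct? u v′ w′ →-dec samePair? (v , w) (v′ , w′)))

  two-other-indices : ∀ (i : I) → ∃₂ λ j k → Distinct i j k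
  two-other-indices = decide (dec-∀ λ i → dec-∃ λ j → dec-∃ λ k → distinct? i j k)

  one-of-two-others : ∀ (i j k l : I) → Distinct i j k → l ≢ i → l ≡ j ⊎ l ≡ k
  one-of-two-others = decide (dec-∀ λ i → dec-∀ λ j → dec-∀ λ k → dec-∀ λ l →
    distinct? i j k →-dec (¬? (l ≟ i) →-dec (l ≟ j ⊎-dec l ≟ k)))

-- The value on the diagonal is junk.
pair : I → I → Pair
pair i₁ i₂ = p₁₂
pair i₁ i₃ = p₁₃
pair i₂ i₁ = p₁₂
pair i₂ i₃ = p₂₃
pair i₃ i₁ = p₁₃
pair i₃ i₂ = p₂₃
pair _  _  = p₁₂

opaque

  pair-comm : ∀ i j → pair i j ≡ pair j i
  pair-comm = decide (dec-∀ λ i → dec-∀ λ j → pair i j ≟ pair j i)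

-- Elements of `S𝒯` carry functions and proofs and can be compared only pointwise. The codes name
-- one bijection for each of the six permutations, which makes exhaustive search possible; through
-- `index` they also serve as permutations of `I`.
data Code : Set where
  ι rot rot⁻¹ : Code
  mirror      : 𝒯 → Code

decode : Code → S𝒯
decode ι          = idₚ
decode rot        = ρ
decode rot⁻¹      = ρ⁻¹
decode (mirror x) = σ x

apply : Code → 𝒯 → 𝒯
apply π = to (decode π)

apply-injective : ∀ π → Injective _≡_ _≡_ (apply π)
apply-injective π {u} {v} eq = trans (sym (Inverse.strictlyInverseʳ (decode π) u))
  (trans (cong (from (decode π)) eq) (Inverse.strictlyInverseʳ (decode π) v))

instance
  finite-Code : Finite Code
  finite-Code = record
    { elements = ι ∷ rot ∷ rot⁻¹ ∷ mirror a ∷ mirror b ∷ mirror c ∷ []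
    ; complete = λ
      { ι → here refl ; rot → there (here refl) ; rot⁻¹ → there (there (here refl))
      ; (mirror a) → there (there (there (here refl)))
      ; (mirror b) → there (there (there (there (here refl))))
      ; (mirror c) → there (there (there (there (there (here refl)))))
      }
    }

opaque

  pair-ends : ∀ e → ∃₂ λ i j → i ≢ j × pair i j ≡ e
  pair-ends = decide (dec-∀ λ e → dec-∃ λ i → dec-∃ λ j → ¬? (i ≟ j) ×-dec pair i j ≟ e)

  adjacent-pairs : ∀ e f → e ≢ f → ∃ λ i → ∃₂ λ j k → Distinct i j k × pair i j ≡ e × pair i k ≡ f
  adjacent-pairs = decide (dec-∀ λ e → dec-∀ λ f → ¬? (e ≟ f) →-dec
    dec-∃ λ i → dec-∃ λ j → dec-∃ λ k → distinct? i j k ×-dec pair i j ≟ e ×-dec pair i k ≟ f)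

  code-of-values : ∀ x y z → Distinct x y z → ∃ λ π → apply π a ≡ x × apply π b ≡ y × apply π c ≡ z
  code-of-values = decide (dec-∀ λ x → dec-∀ λ y → dec-∀ λ z → distinct? x y z →-dec
    dec-∃ λ π → apply π a ≟ x ×-dec apply π b ≟ y ×-dec apply π c ≟ z)

opaque

  code-of : ∀ {f : 𝒯 → 𝒯} → Injective _≡_ _≡_ f → ∃ λ π → ∀ u → apply π u ≡ f u
  code-of {f} f-inj with π , πa , πb , πc ← code-of-values (f a) (f b) (f c)
      ((λ eq → contradiction (f-inj eq) λ ()) , (λ eq → contradiction (f-inj eq) λ ()) ,
         (λ eq → contradiction (f-inj eq) λ ()))
    = π , λ { a → πa ; b → πb ; c → πc }

permute : Code → I → I
permute π i = index (apply π (index⁻¹ i))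

permute-injective : ∀ π → Injective _≡_ _≡_ (permute π)
permute-injective π {i} {j} eq = trans (sym (index∘index⁻¹ i)) (trans (cong index (apply-injective π
  (trans (sym (index⁻¹∘index _)) (trans (cong index⁻¹ eq) (index⁻¹∘index _))))) (index∘index⁻¹ j))

-- A pair is moved by moving its complementary index, which avoids acting on unordered pairs.
permutePair : Code → Pair → Pair
permutePair π e = side (permute π (side⁻¹ e))

permutePair-injective : ∀ π → Injective _≡_ _≡_ (permutePair π)
permutePair-injective π {e} {f} eq = trans (sym (side∘side⁻¹ e)) (trans (cong side (permute-injective π
  (trans (sym (side⁻¹∘side _)) (trans (cong side⁻¹ eq) (side⁻¹∘side _))))) (side∘side⁻¹ f))

opaque

  permutePair-pair : ∀ π i j → i ≢ j → permutePair π (pair i j) ≡ pair (permute π i) (permute π j)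
  permutePair-pair = decide (dec-∀ λ π → dec-∀ λ i → dec-∀ λ j → ¬? (i ≟ j) →-dec
    permutePair π (pair i j) ≟ pair (permute π i) (permute π j))

-- Three free K₅s determine a system of triangle perspectives

open PerspectiveData

-- A copy of the lines of `TP Ξ` inside `𝓛`, required for all indices and orders and not just for
-- those listed in `TP`, so that it is visibly stable under renaming. Counting lines later turns it
-- into an isomorphism.
record Labelling (𝓛 : LineSet 15) (Ξ : PerspectiveData) : Set where
  field
    point       : TPPoint → Fin 15
    injective   : Injective _≡_ _≡_ point
    base        : ∀ {u v w} → Distinct u v w → Line 𝓛 (point (q u)) (point (q v)) (point (q w))
    axis        : ∀ {i j k} → Distinct i j k →
                  Line 𝓛 (point (q₂ (pair i j))) (point (q₂ (pair i k))) (point (q₂ (pair j k)))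
    edge        : ∀ i {u v w} → Distinct u v w → Line 𝓛 (point (q u)) (point (v ⟨ i ⟩)) (point (w ⟨ i ⟩))
    perspective : ∀ {i j} → i ≢ j → ∀ u →
                  Line 𝓛 (point (q₂ (pair i j))) (point (u ⟨ i ⟩)) (point (to (ξ Ξ i j) u ⟨ j ⟩))

module ThreeK₅s {𝓛 : LineSet 15} (cfg : IsConfiguration 15 4 20 3 𝓛)
                (X : I → Subset 15) (X-injective : Injective _≡_ _≡_ X) (K : ∀ i → K₅ 𝓛 (X i)) where

  X-distinct : ∀ {i j} → i ≢ j → X i ≢ X j
  X-distinct i≢j = i≢j ∘ X-injective

  common : Pair → Fin 15
  common p₁₂ = proj₁ (K₅s-meet cfg (K i₁) (K i₂))
  common p₁₃ = proj₁ (K₅s-meet cfg (K i₁) (K i₃))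
  common p₂₃ = proj₁ (K₅s-meet cfg (K i₂) (K i₃))

  meet : I → I → Fin 15
  meet i j = common (pair i j)

  meet-comm : ∀ i j → meet i j ≡ meet j i
  meet-comm i j = cong common (pair-comm i j)

  meet∈ˡ : ∀ {i j} → i ≢ j → meet i j ∈ X i
  meet∈ˡ {i₁} {i₁} i≢j = contradiction refl i≢j
  meet∈ˡ {i₁} {i₂} _   = proj₁ (proj₂ (K₅s-meet cfg (K i₁) (K i₂)))
  meet∈ˡ {i₁} {i₃} _   = proj₁ (proj₂ (K₅s-meet cfg (K i₁) (K i₃)))
  meet∈ˡ {i₂} {i₁} _   = proj₂ (proj₂ (K₅s-meet cfg (K i₁) (K i₂)))
  meet∈ˡ {i₂} {i₂} i≢j = contradiction refl i≢j
  meet∈ˡ {i₂} {i₃} _   = proj₁ (proj₂ (K₅s-meet cfg (K i₂) (K i₃)))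
  meet∈ˡ {i₃} {i₁} _   = proj₂ (proj₂ (K₅s-meet cfg (K i₁) (K i₃)))
  meet∈ˡ {i₃} {i₂} _   = proj₂ (proj₂ (K₅s-meet cfg (K i₂) (K i₃)))
  meet∈ˡ {i₃} {i₃} i≢j = contradiction refl i≢j

  meet∈ʳ : ∀ {i j} → i ≢ j → meet i j ∈ X j
  meet∈ʳ {i} {j} i≢j = subst (_∈ X j) (meet-comm j i) (meet∈ˡ (i≢j ∘ sym))

  meet-unique : ∀ {i j p} → i ≢ j → p ∈ X i → p ∈ X j → p ≡ meet i j
  meet-unique {i} {j} i≢j p∈i p∈j = K₅s-meet-once cfg (K i) (K j) (X-distinct i≢j) p∈i p∈j (meet∈ˡ i≢j) (meet∈ʳ i≢j)

  meet∉ : ∀ {i j k} → Distinct i j k → meet i j ∉ X k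
  meet∉ {i} {j} {k} (i≢j , j≢k , i≢k) = K₅s-not-concurrent cfg (K i) (K j) (K k)
    (X-distinct i≢j) (X-distinct j≢k) (X-distinct i≢k) (meet∈ˡ i≢j) (meet∈ʳ i≢j)

  opaque

    -- The line joining `meet i j` to `meet i k` needs a second point in `X j` and one in `X k`. As
    -- no point is in all three K₅s, its third point serves for both.
    axis-line : ∀ {i j k} → Distinct i j k → Line 𝓛 (meet i j) (meet i k) (meet j k)
    axis-line {i} {j} {k} D@(i≢j , j≢k , i≢k) = through (K₅-edge-line cfg (K i) (meet∈ˡ i≢j) (meet∈ˡ i≢k)
      λ eq → meet∉ D (subst (_∈ X k) (sym eq) (meet∈ʳ i≢k)))
      where
      through : (∃ λ t → Line 𝓛 (meet i j) (meet i k) t) → Line 𝓛 (meet i j) (meet i k) (meet j k)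
      through (t , L) with K₅-meets-line cfg (K j) (meet∈ʳ i≢j) L | K₅-meets-line cfg (K k) (meet∈ʳ i≢k) (swap L)
      ... | inj₁ ik∈j | _         = contradiction ik∈j (meet∉ (i≢k , (j≢k ∘ sym) , i≢j))
      ... | inj₂ _    | inj₁ ij∈k = contradiction ij∈k (meet∉ D)
      ... | inj₂ t∈j  | inj₂ t∈k  = subst (Line 𝓛 (meet i j) (meet i k)) (meet-unique j≢k t∈j t∈k) L

  record InTriangle (i : I) (p : Fin 15) : Set where
    constructor inTriangle
    field
      ∈own    : p ∈ X i
      ∉others : ∀ {k} → k ≢ i → p ∉ X k

  open InTriangle

  Outside : Fin 15 → Set
  Outside p = ∀ k → p ∉ X k

  opaque

    project : ∀ {i j p} → i ≢ j → InTriangle i p → ∃ λ t → InTriangle j t × Line 𝓛 (meet i j) p t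
    project {i} {j} {p} i≢j P = through (K₅-edge-line cfg (K i) (meet∈ˡ i≢j) (∈own P)
      λ { refl → ∉others P (i≢j ∘ sym) (meet∈ʳ i≢j) })
      where
      through : (∃ λ t → Line 𝓛 (meet i j) p t) → ∃ λ t → InTriangle j t × Line 𝓛 (meet i j) p t
      through (t , L) with K₅-meets-line cfg (K j) (meet∈ʳ i≢j) L
      ... | inj₁ p∈j = contradiction p∈j (∉others P (i≢j ∘ sym))
      ... | inj₂ t∈j = t , inTriangle t∈j t∉ , L
        where
        t∉ : ∀ {k} → k ≢ j → t ∉ X k
        t∉ {k} k≢j t∈k with k ≟ i
        ... | yes refl = third∉K₅ (K i) L (meet∈ˡ i≢j) (∈own P) t∈k
        -- Here `t` is `meet j k`, so the line is the axis and `p` would be its remaining point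
        -- `meet i k`.
        ... | no  k≢i  = ∉others P k≢i (subst (_∈ X k)
          (third-unique cfg (swap′ (axis-line (i≢j , (k≢j ∘ sym) , (k≢i ∘ sym))))
            (subst (λ z → Line 𝓛 (meet i j) z p) (meet-unique (k≢j ∘ sym) t∈j t∈k) (swap′ L)))
          (meet∈ʳ (k≢i ∘ sym)))

    third-outside : ∀ {i p p′} → InTriangle i p → InTriangle i p′ → p ≢ p′ → ∃ λ t → Line 𝓛 p p′ t × Outside t
    third-outside {i} {p} {p′} P P′ p≢p′ with t , L ← K₅-edge-line cfg (K i) (∈own P) (∈own P′) p≢p′ = t , L , t∉
      where
      t∉ : Outside t
      t∉ k t∈k with k ≟ i
      ... | yes refl = third∉K₅ (K i) L (∈own P) (∈own P′) t∈k
      ... | no  k≢i with K₅-meets-line cfg (K k) t∈k (rotate (rotate L))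
      ...   | inj₁ p∈k  = ∉others P k≢i p∈k
      ...   | inj₂ p′∈k = ∉others P′ k≢i p′∈k

    -- With `third-outside`, this makes the points outside all K₅s exactly the third points of the
    -- sides of each triangle, so the three triangles share their third points. If an end `p` were
    -- in another `X k`, the line would need a second point there; `p′` would be a second common
    -- point, and `t` is outside.
    outside-third : ∀ {t} → Outside t → ∀ i → ∃₂ λ p p′ → InTriangle i p × InTriangle i p′ × Line 𝓛 p p′ t
    outside-third {t} t∉ i with p , p′ , p∈i , p′∈i , L ← K₅-third-points cfg (K i) (t∉ i)
      = p , p′ , inTriangle p∈i (end L p∈i p′∈i) , inTriangle p′∈i (end (swap L) p′∈i p∈i) , L
      where
      end : ∀ {p p′} → Line 𝓛 p p′ t → p ∈ X i → p′ ∈ X i → ∀ {k} → k ≢ i → p ∉ X k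
      end L p∈i p′∈i {k} k≢i p∈k with K₅-meets-line cfg (K k) p∈k L
      ... | inj₁ p′∈k = p≢r L (K₅s-meet-once cfg (K i) (K k) (X-distinct (k≢i ∘ sym)) p∈i p∈k p′∈i p′∈k)
      ... | inj₂ t∈k  = t∉ k t∈k

  record Enumeration (i : I) : Set where
    field
      vertex      : 𝒯 → Fin 15
      vertex-inj  : Injective _≡_ _≡_ vertex
      vertex∈     : ∀ u → InTriangle i (vertex u)
      vertex-surj : ∀ {p} → InTriangle i p → ∃ λ u → vertex u ≡ p

  size> : ∀ i m {_ : True (m ℕ.<? 5)} → m < ∣ X i ∣
  size> i m {m<5} = subst (m <_) (sym (proj₁ (K i))) (toWitness m<5)

  opaque

    enumerate : ∀ i → Enumeration i
    enumerate i with j , k , D@(i≢j , j≢k , i≢k) ← two-other-indices i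
      with x , x∈ , x∉ ← another-member {X = X i} (meet i j ∷ meet i k ∷ []) (size> i 2)
      with y , y∈ , y∉ ← another-member {X = X i} (x ∷ meet i j ∷ meet i k ∷ []) (size> i 3)
      with z , z∈ , z∉ ← another-member {X = X i} (y ∷ x ∷ meet i j ∷ meet i k ∷ []) (size> i 4)
      = record { vertex = vertex ; vertex-inj = vertex-inj ; vertex∈ = vertex∈ ; vertex-surj = vertex-surj }
      where
      vertex : 𝒯 → Fin 15
      vertex a = x
      vertex b = y
      vertex c = z

      y≢x : y ≢ x
      y≢x y≡x = y∉ (here y≡x)

      z≢y : z ≢ y
      z≢y z≡y = z∉ (here z≡y)

      z≢x : z ≢ x
      z≢x z≡x = z∉ (there (here z≡x))

      vertex-inj : Injective _≡_ _≡_ vertex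
      vertex-inj {a} {a} _ = refl
      vertex-inj {a} {b} x≡y = contradiction (sym x≡y) y≢x
      vertex-inj {a} {c} x≡z = contradiction (sym x≡z) z≢x
      vertex-inj {b} {a} y≡x = contradiction y≡x y≢x
      vertex-inj {b} {b} _ = refl
      vertex-inj {b} {c} y≡z = contradiction (sym y≡z) z≢y
      vertex-inj {c} {a} z≡x = contradiction z≡x z≢x
      vertex-inj {c} {b} z≡y = contradiction z≡y z≢y
      vertex-inj {c} {c} _ = refl

      meets : List (Fin 15)
      meets = meet i j ∷ meet i k ∷ []

      off-meets : ∀ {p} → p ∈ X i → p List.∉ meets → InTriangle i p
      off-meets {p} p∈i p∉meets = inTriangle p∈i λ {l} l≢i p∈l →
        p∉meets (subst (List._∈ meets) (sym (meet-unique (l≢i ∘ sym) p∈i p∈l))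
          (Sum.[ (λ { refl → here refl }) , (λ { refl → there (here refl) }) ]′ (one-of-two-others i j k l D l≢i)))

      vertex∈ : ∀ u → InTriangle i (vertex u)
      vertex∈ a = off-meets x∈ x∉
      vertex∈ b = off-meets y∈ (y∉ ∘ there)
      vertex∈ c = off-meets z∈ (z∉ ∘ there ∘ there)

      all-of-X : ∀ {p} → p ∈ X i → p List.∈ z ∷ y ∷ x ∷ meets
      all-of-X = exhausts
        (All.¬Any⇒All¬ _ z∉ ∷ All.¬Any⇒All¬ _ y∉ ∷ All.¬Any⇒All¬ _ x∉ ∷ (p≢r (axis-line D) ∷ []) ∷ [] ∷ [])
        (λ { (here refl) → z∈ ; (there (here refl)) → y∈ ; (there (there (here refl))) → x∈
           ; (there (there (there (here refl)))) → meet∈ˡ i≢j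
           ; (there (there (there (there (here refl))))) → meet∈ˡ i≢k })
        (ℕ.≤-reflexive (proj₁ (K i)))

      listed : ∀ {p} → InTriangle i p → p List.∈ z ∷ y ∷ x ∷ meets → ∃ λ u → vertex u ≡ p
      listed P (here p≡z)                 = c , sym p≡z
      listed P (there (here p≡y))         = b , sym p≡y
      listed P (there (there (here p≡x))) = a , sym p≡x
      listed P (there (there (there (here refl))))         = contradiction (meet∈ʳ i≢j) (∉others P (i≢j ∘ sym))
      listed P (there (there (there (there (here refl))))) = contradiction (meet∈ʳ i≢k) (∉others P (i≢k ∘ sym))

      vertex-surj : ∀ {p} → InTriangle i p → ∃ λ u → vertex u ≡ p
      vertex-surj P = listed P (all-of-X (∈own P))

  module _ (i : I) where
    open Enumeration (enumerate i) public

  Opposite : I → 𝒯 → Fin 15 → Set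
  Opposite i u t = ∀ {v w} → Distinct u v w → Line 𝓛 (vertex i v) (vertex i w) t

  opaque

    opposite-to : ∀ i {u v w t} → Distinct u v w → Line 𝓛 (vertex i v) (vertex i w) t → Opposite i u t
    opposite-to i {u} {v} {w} D L {v′} {w′} D′ with complement-unique u v w v′ w′ D D′
    ... | inj₁ (refl , refl) = L
    ... | inj₂ (refl , refl) = swap L

    opposite-outside : ∀ i u → ∃ λ t → Opposite i u t × Outside t
    opposite-outside i u with v , w , D@(u≢v , v≢w , u≢w) ← distinct-from-one u
      with t , L , t∉ ← third-outside (vertex∈ i v) (vertex∈ i w) (v≢w ∘ vertex-inj i)
      = t , opposite-to i D L , t∉

    outside-opposite : ∀ {t} → Outside t → ∀ i → ∃ λ u → Opposite i u t
    outside-opposite t∉ i with p , p′ , P , P′ , L ← outside-third t∉ i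
      with v , refl ← vertex-surj i P | w , refl ← vertex-surj i P′
      with u , D ← distinct-from-two v w (p≢r L ∘ cong (vertex i))
      = u , opposite-to i D L

  opposite-uniqueʳ : ∀ i {u t t′} → Opposite i u t → Opposite i u t′ → t ≡ t′
  opposite-uniqueʳ i {u} opp opp′ with v , w , D ← distinct-from-one u = third-unique cfg (opp D) (opp′ D)

  opposite-uniqueˡ : ∀ i {u u′ t} → Opposite i u t → Opposite i u′ t → u ≡ u′
  opposite-uniqueˡ i {u} {u′} opp opp′ with u ≟ u′
  ... | yes u≡u′ = u≡u′
  ... | no  u≢u′ with w , w≢u , _ , w≢u′ ← distinct-from-two u u′ u≢u′
    = vertex-inj i (third-unique cfg (rotate (opp′ ((u≢u′ ∘ sym) , (w≢u ∘ sym) , (w≢u′ ∘ sym))))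
                                     (rotate (opp (u≢u′ , (w≢u′ ∘ sym) , (w≢u ∘ sym)))))

  centre : 𝒯 → Fin 15
  centre u = proj₁ (opposite-outside i₁ u)

  centre-outside : ∀ u → Outside (centre u)
  centre-outside u = proj₂ (proj₂ (opposite-outside i₁ u))

  centre-opposite : ∀ u → Opposite i₁ u (centre u)
  centre-opposite u = proj₁ (proj₂ (opposite-outside i₁ u))

  centre-injective : Injective _≡_ _≡_ centre
  centre-injective {u} {u′} eq =
    opposite-uniqueˡ i₁ (centre-opposite u) (subst (Opposite i₁ u′) (sym eq) (centre-opposite u′))

  outside⇒centre : ∀ {t} → Outside t → ∃ λ u → t ≡ centre u
  outside⇒centre t∉ with u , opp ← outside-opposite t∉ i₁ = u , opposite-uniqueʳ i₁ opp (centre-opposite u)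

  -- The vertices of a triangle were enumerated arbitrarily, and `centre` takes its names from the
  -- first triangle. Renaming each vertex after the centre on the opposite side makes the names in
  -- the three triangles agree.
  relabel : I → 𝒯 → 𝒯
  relabel i u = proj₁ (outside-opposite (centre-outside u) i)

  relabel-opposite : ∀ i u → Opposite i (relabel i u) (centre u)
  relabel-opposite i u = proj₂ (outside-opposite (centre-outside u) i)

  relabel-injective : ∀ i → Injective _≡_ _≡_ (relabel i)
  relabel-injective i {u} {u′} eq = centre-injective (opposite-uniqueʳ i (relabel-opposite i u)
    (subst (λ w → Opposite i w (centre u′)) (sym eq) (relabel-opposite i u′)))

  corner : I → 𝒯 → Fin 15
  corner i u = vertex i (relabel i u)

  corner∈ : ∀ i u → InTriangle i (corner i u)
  corner∈ i u = vertex∈ i (relabel i u)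

  corner-injective : ∀ i → Injective _≡_ _≡_ (corner i)
  corner-injective i = relabel-injective i ∘ vertex-inj i

  opaque

    corner-surjective : ∀ i {p} → InTriangle i p → ∃ λ u → corner i u ≡ p
    corner-surjective i P with v , refl ← vertex-surj i P with π , π≗ ← code-of (relabel-injective i)
      = from (decode π) v , cong (vertex i) (trans (sym (π≗ _)) (Inverse.strictlyInverseˡ (decode π) v))

    edge-line-of : ∀ i {u v w} → Distinct u v w → Line 𝓛 (centre u) (corner i v) (corner i w)
    edge-line-of i {u} (u≢v , v≢w , u≢w) = rotate (rotate (relabel-opposite i u
      ((u≢v ∘ relabel-injective i) , (v≢w ∘ relabel-injective i) , (u≢w ∘ relabel-injective i))))

  opaque

    -- Three of the four lines through a centre lie along the triangles; the fourth avoids all three K₅s.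
    base-line : ∀ {u v w} → Distinct u v w → Line 𝓛 (centre u) (centre v) (centre w)
    base-line {u} {v} {w} D = fourth-line (fresh _≟ₛ_ along (Unique.filter⁺ (centre u ∈?_) (distinct cfg))
      (subst (3 <_) (sym (point-degree cfg (centre u))) ℕ.≤-refl))
      where
      along : LineSet 15
      along = List.map (λ i → carrier (edge-line-of i D)) (i₁ ∷ i₂ ∷ i₃ ∷ [])

      all-centres : ∀ {t t′} → Line 𝓛 (centre u) t t′ → Outside t → Outside t′ →
                    Line 𝓛 (centre u) (centre v) (centre w)
      all-centres L t∉ t′∉ with x , refl ← outside⇒centre t∉ | y , refl ← outside⇒centre t′∉
        with complement-unique u v w x y D ((p≢r L ∘ cong centre) , (r≢s L ∘ cong centre) , (p≢s L ∘ cong centre))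
      ... | inj₁ (refl , refl) = L
      ... | inj₂ (refl , refl) = swap′ L

      -- A point of `X i` on the line would make it the line of an edge of `X i` with third point
      -- `centre u`; the only such edge is the one already in `along`.
      off-cliques : ∀ {t t′} (L : Line 𝓛 (centre u) t t′) → carrier L List.∉ along → Outside t
      off-cliques {t} {t′} L ℓ∉ i t∈i with K₅-meets-line cfg (K i) t∈i (swap L)
      ... | inj₁ u∈i  = centre-outside u i u∈i
      ... | inj₂ t′∈i = ℓ∉ (subst (List._∈ along) (sym (same-carrier
        (K₅-edge-unique cfg (K i) t∈i t′∈i (∈own (corner∈ i v)) (∈own (corner∈ i w))
          (rotate L) (rotate (edge-line-of i D)))))
        (List.∈-map⁺ (λ i → carrier (edge-line-of i D)) (complete i)))
        where
        same-carrier : SamePair (t , t′) (corner i v , corner i w) → carrier L ≡ carrier (edge-line-of i D)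
        same-carrier (inj₁ (refl , _)) = carrier-unique cfg (edge-line-of i D) (carrier∈ L) (p∈ L) (r∈ L)
        same-carrier (inj₂ (refl , refl)) = carrier-unique cfg (edge-line-of i D) (carrier∈ L) (p∈ L) (s∈ L)

      fourth-line : (∃ λ ℓ → ℓ List.∈ filter (centre u ∈?_) 𝓛 × ℓ List.∉ along) →
                    Line 𝓛 (centre u) (centre v) (centre w)
      fourth-line (ℓ , ℓ∈ , ℓ∉)
        with ℓ∈𝓛 , u∈ℓ ← List.∈-filter⁻ (centre u ∈?_) ℓ∈
        with t , t∈ℓ , t∉ ← another-member {X = ℓ} (centre u ∷ [])
               (subst (1 <_) (sym (line-size cfg ℓ ℓ∈𝓛)) (s≤s (s≤s z≤n)))
        with t′ , L , refl ← complete-line cfg ℓ∈𝓛 u∈ℓ t∈ℓ (λ u≡t → t∉ (here (sym u≡t)))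
        = all-centres L (off-cliques L ℓ∉) (off-cliques (swap′ L) ℓ∉)

  shift : ∀ {i j} → i ≢ j → 𝒯 → 𝒯
  shift {i} {j} i≢j u = proj₁ (corner-surjective j (proj₁ (proj₂ (project i≢j (corner∈ i u)))))

  opaque

    shift-line : ∀ {i j} (i≢j : i ≢ j) u → Line 𝓛 (meet i j) (corner i u) (corner j (shift i≢j u))
    shift-line {i} {j} i≢j u with t , T , L ← project i≢j (corner∈ i u) with w , refl ← corner-surjective j T = L

  shift-injective : ∀ {i j} (i≢j : i ≢ j) → Injective _≡_ _≡_ (shift i≢j)
  shift-injective {i} {j} i≢j {u} {u′} eq = corner-injective i (third-unique cfg (swap′ (shift-line i≢j u))
    (swap′ (subst (λ w → Line 𝓛 (meet i j) (corner i u′) (corner j w)) (sym eq) (shift-line i≢j u′))))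

  opaque

    perspectivity : ∀ {i j} → i ≢ j → ∃ λ π → ∀ u → Line 𝓛 (meet i j) (corner i u) (corner j (apply π u))
    perspectivity {i} {j} i≢j with π , π≗ ← code-of (shift-injective i≢j)
      = π , λ u → subst (λ w → Line 𝓛 (meet i j) (corner i u) (corner j w)) (sym (π≗ u)) (shift-line i≢j u)

  point : TPPoint → Fin 15
  point (q u)     = centre u
  point (u ⟨ i ⟩) = corner i u
  point (q₂ e)    = common e

  corner≢common : ∀ i u e → corner i u ≢ common e
  corner≢common i u e eq with j , k , j≢k , refl ← pair-ends e with j ≟ i
  ... | no  j≢i  = ∉others (corner∈ i u) j≢i (subst (_∈ X j) (sym eq) (meet∈ˡ j≢k))
  ... | yes refl = ∉others (corner∈ i u) (j≢k ∘ sym) (subst (_∈ X k) (sym eq) (meet∈ʳ j≢k))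

  centre≢corner : ∀ u i v → centre u ≢ corner i v
  centre≢corner u i v eq = centre-outside u i (subst (_∈ X i) (sym eq) (∈own (corner∈ i v)))

  centre≢common : ∀ u e → centre u ≢ common e
  centre≢common u e eq with j , k , j≢k , refl ← pair-ends e =
    centre-outside u j (subst (_∈ X j) (sym eq) (meet∈ˡ j≢k))

  common-injective : Injective _≡_ _≡_ common
  common-injective {e} {e′} eq with e ≟ e′
  ... | yes e≡e′ = e≡e′
  ... | no  e≢e′ with i , j , k , D , refl , refl ← adjacent-pairs e e′ e≢e′ =
    contradiction eq (p≢r (axis-line D))

  point-injective : Injective _≡_ _≡_ point
  point-injective {q u}     {q v}     eq = cong q (centre-injective eq)
  point-injective {q u}     {v ⟨ j ⟩} eq = contradiction eq (centre≢corner u j v)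
  point-injective {q u}     {q₂ e}    eq = contradiction eq (centre≢common u e)
  point-injective {u ⟨ i ⟩} {q v}     eq = contradiction (sym eq) (centre≢corner v i u)
  point-injective {u ⟨ i ⟩} {v ⟨ j ⟩} eq with j ≟ i
  ... | no  j≢i  = contradiction (subst (_∈ X j) (sym eq) (∈own (corner∈ j v))) (∉others (corner∈ i u) j≢i)
  ... | yes refl = cong _⟨ i ⟩ (corner-injective i eq)
  point-injective {u ⟨ i ⟩} {q₂ e}    eq = contradiction eq (corner≢common i u e)
  point-injective {q₂ e}    {q v}     eq = contradiction (sym eq) (centre≢common v e)
  point-injective {q₂ e}    {v ⟨ j ⟩} eq = contradiction (sym eq) (corner≢common j v e)
  point-injective {q₂ e}    {q₂ f}    eq = cong q₂ (common-injective eq)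

  code : ∀ {i j} → i ≢ j → Code
  code i≢j = proj₁ (perspectivity i≢j)

  1≢2 : i₁ ≢ i₂
  1≢2 ()

  2≢3 : i₂ ≢ i₃
  2≢3 ()

  1≢3 : i₁ ≢ i₃
  1≢3 ()

  perspectivity⁻¹ : ∀ {i j} (i≢j : i ≢ j) u → Line 𝓛 (meet i j) (corner j u) (corner i (from (decode (code i≢j)) u))
  perspectivity⁻¹ {i} {j} i≢j u = swap′ (subst (λ w → Line 𝓛 (meet i j) (corner i (from π u)) (corner j w))
    (Inverse.strictlyInverseˡ π u) (proj₂ (perspectivity i≢j) (from π u)))
    where π = decode (code i≢j)

  labelling : Labelling 𝓛 (determinedBy (decode (code 1≢2) , decode (code 2≢3) , decode (code 1≢3)))
  labelling = record
    { point       = point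
    ; injective   = point-injective
    ; base        = base-line
    ; axis        = axis-line
    ; edge        = edge-line-of
    ; perspective = persp
    }
    where
    Ξ = determinedBy (decode (code 1≢2) , decode (code 2≢3) , decode (code 1≢3))

    persp : ∀ {i j} → i ≢ j → ∀ u → Line 𝓛 (meet i j) (corner i u) (corner j (to (ξ Ξ i j) u))
    persp {i₁} {i₁} i≢i = contradiction refl i≢i
    persp {i₁} {i₂} _   = proj₂ (perspectivity 1≢2)
    persp {i₁} {i₃} _   = proj₂ (perspectivity 1≢3)
    persp {i₂} {i₁} _   = perspectivity⁻¹ 1≢2
    persp {i₂} {i₂} i≢i = contradiction refl i≢i
    persp {i₂} {i₃} _   = proj₂ (perspectivity 2≢3)
    persp {i₃} {i₁} _   = perspectivity⁻¹ 1≢3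
    persp {i₃} {i₂} _   = perspectivity⁻¹ 2≢3
    persp {i₃} {i₃} i≢i = contradiction refl i≢i

-- Embeddings and relabellings

open Labelling

module _ {n} (π : Permutation n n) {X : Subset n} where

  ∈-image⁺ : ∀ {p} → p ∈ X → π ⟨$⟩ʳ p ∈ image π X
  ∈-image⁺ {p} p∈X = Vec.lookup⇒[]= _ _ (trans (Vec.lookup∘tabulate _ (π ⟨$⟩ʳ p))
    (trans (cong (lookup X) (inverseˡ π)) (Vec.[]=⇒lookup p∈X)))

  ∈-image⁻ : ∀ {p} → p ∈ image π X → π ⟨$⟩ˡ p ∈ X
  ∈-image⁻ {p} p∈ = Vec.lookup⇒[]= _ _ (trans (sym (Vec.lookup∘tabulate _ p)) (Vec.[]=⇒lookup p∈))

  image-flip : image (flip π) (image π X) ≡ X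
  image-flip = trans (Vec.tabulate-cong λ p → trans (Vec.lookup∘tabulate _ (π ⟨$⟩ʳ p)) (cong (lookup X) (inverseˡ π)))
    (Vec.tabulate∘lookup X)

  image-∘ : ∀ (φ : Permutation n n) → image φ (image π X) ≡ image (π ∘ₚ φ) X
  image-∘ φ = Vec.tabulate-cong λ p → Vec.lookup∘tabulate _ (φ ⟨$⟩ˡ p)

injective⇒permutation : ∀ {n} {f : Fin n → Fin n} → Injective _≡_ _≡_ f → Permutation n n
injective⇒permutation {f = f} f-inj = permutation f (proj₁ ∘ injective⇒surjective f-inj)
  (proj₂ ∘ injective⇒surjective f-inj)
  (λ x → f-inj (proj₂ (injective⇒surjective f-inj (f x))))

record Embeds {n} (𝓜 𝓛 : LineSet n) : Set where
  constructor embedding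
  field
    bijection : Permutation n n
    preserves : All (λ m → image bijection m List.∈ 𝓛) 𝓜

Embeds-trans : ∀ {n} {𝓝 𝓜 𝓛 : LineSet n} → Embeds 𝓝 𝓜 → Embeds 𝓜 𝓛 → Embeds 𝓝 𝓛
Embeds-trans (embedding π ps) (embedding φ qs) = embedding (π ∘ₚ φ)
  (All.map (λ {m} m∈ → subst (List._∈ _) (image-∘ π {m} φ) (All.lookup qs m∈)) ps)

-- The inverse bijection sends the lines of `𝓛` onto a list that contains `𝓜`; since `𝓜` has no
-- repetitions and `𝓛` is no longer than `𝓜`, nothing else can occur.
Embeds⇒≅ : ∀ {n} {𝓜 𝓛 : LineSet n} → Unique 𝓜 → length 𝓛 ≤ length 𝓜 → Embeds 𝓜 𝓛 → 𝓛 ≅ 𝓜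
Embeds⇒≅ {𝓜 = 𝓜} {𝓛} 𝓜! 𝓛≤𝓜 (embedding π ps) = flip π , mk⇔
  (unique-⊆⇒⊇ _≟ₛ_ 𝓜! 𝓜⊆ (subst (_≤ length 𝓜) (sym (List.length-map (image (flip π)) 𝓛)) 𝓛≤𝓜)) 𝓜⊆
  where
  𝓜⊆ : ∀ {m} → m List.∈ 𝓜 → m List.∈ List.map (image (flip π)) 𝓛
  𝓜⊆ {m} m∈ = subst (List._∈ List.map (image (flip π)) 𝓛) (image-flip π {m})
    (List.∈-map⁺ (image (flip π)) (All.lookup ps m∈))

number : TPPoint → Fin 15
number = to TPPoint↔Fin15

module _ {𝓛 : LineSet 15} {d l} (cfg : IsConfiguration 15 d l 3 𝓛) {Ξ} (Λ : Labelling 𝓛 Ξ) where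

  place : Fin 15 → Fin 15
  place = point Λ ∘ from TPPoint↔Fin15

  place-injective : Injective _≡_ _≡_ place
  place-injective {m} {n} eq = trans (sym (Inverse.strictlyInverseˡ TPPoint↔Fin15 m))
    (trans (cong number (injective Λ eq)) (Inverse.strictlyInverseˡ TPPoint↔Fin15 n))

  placement : Permutation 15 15
  placement = injective⇒permutation place-injective

  place-number : ∀ x → place (number x) ≡ point Λ x
  place-number x = cong (point Λ) (Inverse.strictlyInverseʳ TPPoint↔Fin15 x)

  ∈-⟦⟧⁻ : ∀ {x y z p} → p ∈ ⟦ x , y , z ⟧ → p ≡ number x ⊎ p ≡ number y ⊎ p ≡ number z
  ∈-⟦⟧⁻ {x} {y} {z} p∈ with x∈p∪q⁻ ⁅ number x ⁆ (⁅ number y ⁆ ∪ ⁅ number z ⁆) p∈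
  ... | inj₁ p∈x = inj₁ (x∈⁅y⁆⇒x≡y _ p∈x)
  ... | inj₂ p∈yz with x∈p∪q⁻ ⁅ number y ⁆ ⁅ number z ⁆ p∈yz
  ...   | inj₁ p∈y = inj₂ (inj₁ (x∈⁅y⁆⇒x≡y _ p∈y))
  ...   | inj₂ p∈z = inj₂ (inj₂ (x∈⁅y⁆⇒x≡y _ p∈z))

  image-⟦⟧ : ∀ x y z (L : Line 𝓛 (point Λ x) (point Λ y) (point Λ z)) → image placement ⟦ x , y , z ⟧ List.∈ 𝓛
  image-⟦⟧ x y z L = subst (List._∈ 𝓛) (⊆-antisym carrier⊆ ⊆carrier) (carrier∈ L)
    where
    placed : ∀ {p} u → number u ∈ ⟦ x , y , z ⟧ → p ≡ point Λ u → p ∈ image placement ⟦ x , y , z ⟧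
    placed u u∈ refl = subst (_∈ image placement ⟦ x , y , z ⟧) (place-number u) (∈-image⁺ placement u∈)

    listed : ∀ {p} → p List.∈ point Λ x ∷ point Λ y ∷ point Λ z ∷ [] → p ∈ image placement ⟦ x , y , z ⟧
    listed (here p≡)                 = placed x (x∈p∪q⁺ (inj₁ (x∈⁅x⁆ _))) p≡
    listed (there (here p≡))         = placed y (x∈p∪q⁺ (inj₂ (x∈p∪q⁺ (inj₁ (x∈⁅x⁆ _))))) p≡
    listed (there (there (here p≡))) = placed z (x∈p∪q⁺ (inj₂ (x∈p∪q⁺ (inj₂ (x∈⁅x⁆ _))))) p≡

    carrier⊆ : carrier L ⊆ image placement ⟦ x , y , z ⟧
    carrier⊆ p∈ = listed (on-line cfg L p∈)

    carried : ∀ {p} u → point Λ u ∈ carrier L → placement ⟨$⟩ˡ p ≡ number u → p ∈ carrier L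
    carried u u∈ eq =
      subst (_∈ carrier L) (trans (sym (place-number u)) (trans (cong place (sym eq)) (inverseʳ placement))) u∈

    unplaced : ∀ {p} → let k = placement ⟨$⟩ˡ p in k ≡ number x ⊎ k ≡ number y ⊎ k ≡ number z → p ∈ carrier L
    unplaced (inj₁ eq)        = carried x (p∈ L) eq
    unplaced (inj₂ (inj₁ eq)) = carried y (r∈ L) eq
    unplaced (inj₂ (inj₂ eq)) = carried z (s∈ L) eq

    ⊆carrier : image placement ⟦ x , y , z ⟧ ⊆ carrier L
    ⊆carrier p∈ = unplaced (∈-⟦⟧⁻ (∈-image⁻ placement p∈))

  TP-embeds : Embeds (TP Ξ) 𝓛
  TP-embeds = embedding placement
    ( image-⟦⟧ (q a) (q b) (q c) (base Λ abc)
    ∷ image-⟦⟧ (q₂ p₁₂) (q₂ p₁₃) (q₂ p₂₃) (axis Λ {i₁} {i₂} {i₃} ((λ ()) , (λ ()) , λ ()))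
    ∷ All.++⁺ (triangle i₁) (All.++⁺ (triangle i₂) (All.++⁺ (triangle i₃)
      (All.++⁺ (perspectives i₁ i₂ λ ()) (All.++⁺ (perspectives i₁ i₃ λ ()) (perspectives i₂ i₃ λ ()))))))
    where
    abc : Distinct a b c
    abc = (λ ()) , (λ ()) , λ ()

    bac : Distinct b a c
    bac = (λ ()) , (λ ()) , λ ()

    cab : Distinct c a b
    cab = (λ ()) , (λ ()) , λ ()

    Placed : Subset 15 → Set
    Placed m = image placement m List.∈ 𝓛

    triangle : ∀ i → All Placed
      (⟦ q a , b ⟨ i ⟩ , c ⟨ i ⟩ ⟧ ∷ ⟦ q b , a ⟨ i ⟩ , c ⟨ i ⟩ ⟧ ∷ ⟦ q c , a ⟨ i ⟩ , b ⟨ i ⟩ ⟧ ∷ [])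
    triangle i = image-⟦⟧ (q a) (b ⟨ i ⟩) (c ⟨ i ⟩) (edge Λ i abc)
               ∷ image-⟦⟧ (q b) (a ⟨ i ⟩) (c ⟨ i ⟩) (edge Λ i bac)
               ∷ image-⟦⟧ (q c) (a ⟨ i ⟩) (b ⟨ i ⟩) (edge Λ i cab)
               ∷ []

    perspectives : ∀ i j → i ≢ j → All Placed
      (List.map (λ u → ⟦ q₂ (pair i j) , u ⟨ i ⟩ , to (ξ Ξ i j) u ⟨ j ⟩ ⟧) (a ∷ b ∷ c ∷ []))
    perspectives i j i≢j = line a ∷ line b ∷ line c ∷ []
      where
      line : ∀ u → Placed ⟦ q₂ (pair i j) , u ⟨ i ⟩ , to (ξ Ξ i j) u ⟨ j ⟩ ⟧
      line u = image-⟦⟧ (q₂ (pair i j)) (u ⟨ i ⟩) (to (ξ Ξ i j) u ⟨ j ⟩) (perspective Λ i≢j u)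

-- Simultaneous renaming of 𝒯 and I

Distinct-map : ∀ {A B : Set} {f : A → B} → Injective _≡_ _≡_ f →
               ∀ {x y z} → Distinct x y z → Distinct (f x) (f y) (f z)
Distinct-map f-inj (x≢y , y≢z , x≢z) = (x≢y ∘ f-inj) , (y≢z ∘ f-inj) , (x≢z ∘ f-inj)

-- One `τ` serves all indices because the sides of every triangle run through the same qᵃ, qᵇ, qᶜ.
-- The action is conjugation by `τ`, not an independent change of names in each triangle.
record Matches (Ξ′ Ξ : PerspectiveData) (τ π : Code) : Set where
  constructor matches
  field match : ∀ {i j} → i ≢ j → ∀ u → apply τ (to (ξ Ξ′ i j) u) ≡ to (ξ Ξ (permute π i) (permute π j)) (apply τ u)

open Matches

matches? : ∀ Ξ′ Ξ τ π → Dec (Matches Ξ′ Ξ τ π)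
matches? Ξ′ Ξ τ π = map′ (λ m → matches λ {i} {j} → m i j) (λ M i j → match M)
  (dec-∀ λ i → dec-∀ λ j → ¬? (i ≟ j) →-dec dec-∀ λ u → _ ≟ _)

relabelling : ∀ {𝓛 Ξ Ξ′ τ π} → Matches Ξ′ Ξ τ π → Labelling 𝓛 Ξ → Labelling 𝓛 Ξ′
relabelling {𝓛} {Ξ} {Ξ′} {τ} {π} M Λ = record
  { point       = point Λ ∘ rename
  ; injective   = rename-injective ∘ injective Λ
  ; base        = λ D → base Λ (Distinct-map (apply-injective τ) D)
  ; axis        = axis′
  ; edge        = λ i D → edge Λ (permute π i) (Distinct-map (apply-injective τ) D)
  ; perspective = perspective′
  }
  where
  rename : TPPoint → TPPoint
  rename (q u)     = q (apply τ u)
  rename (u ⟨ i ⟩) = apply τ u ⟨ permute π i ⟩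
  rename (q₂ e)    = q₂ (permutePair π e)

  rename-injective : Injective _≡_ _≡_ rename
  rename-injective {q _}     {q _}     eq = cong q (apply-injective τ (q-injective eq))
    where
    q-injective : ∀ {u v} → q u ≡ q v → u ≡ v
    q-injective refl = refl
  rename-injective {_ ⟨ _ ⟩} {_ ⟨ _ ⟩} eq =
    cong₂ _⟨_⟩ (apply-injective τ (proj₁ (⟨⟩-injective eq))) (permute-injective π (proj₂ (⟨⟩-injective eq)))
    where
    ⟨⟩-injective : ∀ {u v i j} → u ⟨ i ⟩ ≡ v ⟨ j ⟩ → u ≡ v × i ≡ j
    ⟨⟩-injective refl = refl , refl
  rename-injective {q₂ _}    {q₂ _}    eq = cong q₂ (permutePair-injective π (q₂-injective eq))
    where
    q₂-injective : ∀ {e f} → q₂ e ≡ q₂ f → e ≡ f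
    q₂-injective refl = refl

  axis′ : ∀ {i j k} → Distinct i j k →
          Line 𝓛 (point Λ (rename (q₂ (pair i j)))) (point Λ (rename (q₂ (pair i k)))) (point Λ (rename (q₂ (pair j k))))
  axis′ {i} {j} {k} D@(i≢j , j≢k , i≢k)
    rewrite permutePair-pair π i j i≢j | permutePair-pair π i k i≢k | permutePair-pair π j k j≢k
    = axis Λ (Distinct-map (permute-injective π) D)

  perspective′ : ∀ {i j} → i ≢ j → ∀ u →
                 Line 𝓛 (point Λ (rename (q₂ (pair i j)))) (point Λ (rename (u ⟨ i ⟩)))
                        (point Λ (rename (to (ξ Ξ′ i j) u ⟨ j ⟩)))
  perspective′ {i} {j} i≢j u rewrite permutePair-pair π i j i≢j | match M i≢j u
    = perspective Λ (i≢j ∘ permute-injective π) (apply τ u)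

-- Classification of the triples

systemOf : Code → Code → Code → PerspectiveData
systemOf α β γ = determinedBy (decode α , decode β , decode γ)

-- Representatives of the orbits of triples under renaming 𝒯 and I; the first one is isomorphic to (id, id, σ x).
orbits : 𝒯 → 𝒯 → 𝒯 → Vec Triple 18
orbits x y z = (idₚ , σ x , σ x) ∷ triples x y z

representative : 𝒯 → 𝒯 → 𝒯 → Fin 18 → PerspectiveData
representative x y z n = determinedBy (lookup (orbits x y z) n)

-- The number of even permutations: they are the ones that preserve the cyclic order, as the images
-- of `a` and `b` already show. Conjugation, and the inversion caused by exchanging two indices,
-- preserve parity.
rotations : PerspectiveData → ℕ
rotations Ξ = rotation (ξ Ξ i₁ i₂) + (rotation (ξ Ξ i₂ i₃) + rotation (ξ Ξ i₁ i₃))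
  where
  rotation : S𝒯 → ℕ
  rotation f = if does (to f b ≟ to ρ (to f a)) then 1 else 0

-- Comparing the numbers of rotations first is logically redundant, but shortens the search.
Equivalent : PerspectiveData → PerspectiveData → Set
Equivalent Ξ′ Ξ = rotations Ξ′ ≡ rotations Ξ × ∃₂ (Matches Ξ′ Ξ)

equivalent? : ∀ Ξ′ Ξ → Dec (Equivalent Ξ′ Ξ)
equivalent? Ξ′ Ξ = rotations Ξ′ ℕ.≟ rotations Ξ ×-dec dec-∃ λ τ → dec-∃ λ π → matches? Ξ′ Ξ τ π

opaque

  -- The 216 triples are searched for one ordering of the letters only; for any other ordering,
  -- `reorientation` has just the eighteen representatives to compare.
  classification : ∀ α β γ → ∃ λ n → Equivalent (representative a b c n) (systemOf α β γ)
  classification = decide (dec-∀ λ α → dec-∀ λ β → dec-∀ λ γ → Fin.any? λ n →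
    equivalent? (representative a b c n) (systemOf α β γ))

  reorientation : ∀ x y z → Distinct x y z → ∀ n → ∃ λ m → Equivalent (representative x y z m) (representative a b c n)
  reorientation = decide (dec-∀ λ x → dec-∀ λ y → dec-∀ λ z → distinct? x y z →-dec Fin.all? λ n →
    Fin.any? λ m → equivalent? (representative x y z m) (representative a b c n))

-- All three permutations fix `x`, so {qʸ, qᶻ, x₁, x₂, x₃} is a free K₅. This involution exchanges
-- it with the first K₅ and keeps the other two; swapping y₂ and z₂ turns the identity between the
-- second and third triangles into `σ x`.
exchange : 𝒯 → 𝒯 → 𝒯 → Permutation 15 15
exchange x y z =
  transpose (number (q y)) (number (y ⟨ i₁ ⟩)) ∘ₚ
  transpose (number (q z)) (number (z ⟨ i₁ ⟩)) ∘ₚ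
  transpose (number (x ⟨ i₂ ⟩)) (number (q₂ p₁₂)) ∘ₚ
  transpose (number (x ⟨ i₃ ⟩)) (number (q₂ p₁₃)) ∘ₚ
  transpose (number (y ⟨ i₂ ⟩)) (number (z ⟨ i₂ ⟩))

opaque

  exchange-preserves : ∀ x y z → Distinct x y z →
    All (λ m → image (exchange x y z) m List.∈ TP (determinedBy (idₚ , σ x , σ x))) (TP (determinedBy (idₚ , idₚ , σ x)))
  exchange-preserves = decide (dec-∀ λ x → dec-∀ λ y → dec-∀ λ z → distinct? x y z →-dec
    All.all? (λ m → any? (image (exchange x y z) m ≟ₛ_) _) _)

-- The seventeen systems are configurations with three free K₅s

-- Sufficient conditions for IsConfiguration and FreelyContains that are cheap to evaluate.

IsConfigurationᶜ : LineSet 15 → Set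
IsConfigurationᶜ 𝓛 = length 𝓛 ≡ 20 × (∀ p → length (filter (p ∈?_) 𝓛) ≡ 4) × All (λ ℓ → ∣ ℓ ∣ ≡ 3) 𝓛
                   × AllPairs (λ ℓ m → ∣ ℓ ∩ m ∣ ≤ 1) 𝓛

isConfigurationᶜ? : ∀ 𝓛 → Dec (IsConfigurationᶜ 𝓛)
isConfigurationᶜ? 𝓛 =
  length 𝓛 ℕ.≟ 20 ×-dec Fin.all? (λ p → length (filter (p ∈?_) 𝓛) ℕ.≟ 4) ×-dec
  All.all? (λ ℓ → ∣ ℓ ∣ ℕ.≟ 3) 𝓛 ×-dec AllPairs.allPairs? (λ ℓ m → ∣ ℓ ∩ m ∣ ℕ.≤? 1) 𝓛

two-members : ∀ {n} {X : Subset n} → ∣ X ∣ ≡ 2 → ∃₂ λ p r → p ≢ r × p ∈ X × r ∈ X × X ⊆ p ∙∙ r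
two-members {X = X} ∣X∣≡2
  with p , p∈X , _ ← another-member {X = X} [] (subst (0 <_) (sym ∣X∣≡2) (s≤s z≤n))
  with r , r∈X , r∉[p] ← another-member {X = X} (p ∷ []) (subst (1 <_) (sym ∣X∣≡2) (s≤s (s≤s z≤n)))
  = p , r , apart , p∈X , r∈X , λ x∈X → listed (exhausts ((apart ∷ []) ∷ [] ∷ [])
      (λ { (here refl) → p∈X ; (there (here refl)) → r∈X }) (ℕ.≤-reflexive ∣X∣≡2) x∈X)
  where
  apart : p ≢ r
  apart p≡r = r∉[p] (here (sym p≡r))

  listed : ∀ {x} → x List.∈ p ∷ r ∷ [] → x ∈ p ∙∙ r
  listed (here refl)         = ∈-∙∙ˡ
  listed (there (here refl)) = ∈-∙∙ʳ

isConfiguration : ∀ {𝓛} → IsConfigurationᶜ 𝓛 → IsConfiguration 15 4 20 3 𝓛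
isConfiguration (length≡ , degree , size , meet≤1) = record
  { distinct     = unique size meet≤1
  ; line-count   = length≡
  ; point-degree = degree
  ; line-size    = λ ℓ → All.lookup size
  ; linear       = λ p r p≢r ℓ m ℓ∈ m∈ p∈ℓ r∈ℓ p∈m r∈m → same-line meet≤1 p≢r ℓ∈ m∈ p∈ℓ r∈ℓ p∈m r∈m
  }
  where
  -- Two equal lines in the list would meet in three points.
  unique : ∀ {𝓛} → All (λ ℓ → ∣ ℓ ∣ ≡ 3) 𝓛 → AllPairs (λ ℓ m → ∣ ℓ ∩ m ∣ ≤ 1) 𝓛 → Unique 𝓛
  unique []             []              = []
  unique {ℓ ∷ _} (∣ℓ∣≡3 ∷ size) (ℓ∩≤1 ∷ meet≤1) = All.map (λ { ∣ℓ∩ℓ∣≤1 refl → contradiction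
    (subst (_≤ 1) (trans (cong ∣_∣ (∩-idem ℓ)) ∣ℓ∣≡3) ∣ℓ∩ℓ∣≤1) λ { (s≤s ()) } }) ℓ∩≤1 ∷ unique size meet≤1

  same-line : ∀ {𝓛 p r ℓ m} → AllPairs (λ ℓ m → ∣ ℓ ∩ m ∣ ≤ 1) 𝓛 → p ≢ r → ℓ List.∈ 𝓛 → m List.∈ 𝓛 →
              p ∈ ℓ → r ∈ ℓ → p ∈ m → r ∈ m → ℓ ≡ m
  same-line meet≤1 p≢r ℓ∈ m∈ p∈ℓ r∈ℓ p∈m r∈m
    with allPairs-lookup (λ {ℓ} {m} → subst (_≤ 1) (cong ∣_∣ (∩-comm ℓ m))) meet≤1 ℓ∈ m∈
  ... | inj₁ ℓ≡m     = ℓ≡m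
  ... | inj₂ ∣ℓ∩m∣≤1 = contradiction ∣ℓ∩m∣≤1 (ℕ.<⇒≱ (subst (_≤ _) (∣∙∙∣ p≢r)
    (p⊆q⇒∣p∣≤∣q∣ (∙∙-⊆ (x∈p∩q⁺ (p∈ℓ , p∈m)) (x∈p∩q⁺ (r∈ℓ , r∈m))))))

secants : Subset 15 → LineSet 15 → LineSet 15
secants X = filter (λ ℓ → ∣ ℓ ∩ X ∣ ℕ.≟ 2)

SecantsDisjointOutside : Subset 15 → LineSet 15 → Set
SecantsDisjointOutside X 𝓢 = ∀ p → p ∉ X → length (filter (p ∈?_) 𝓢) ≤ 1

-- As no line has three points in `X`, an edge is the trace of its line on `X`. Lines of two edges
-- that meet inside `X` thus share a vertex there, and freeness reduces to having at most one secant
-- through each outside point.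
FreelyContainsᶜ : LineSet 15 → Subset 15 → Set
FreelyContainsᶜ 𝓛 X = AllPairs (λ p r → Any (λ ℓ → p ∈ ℓ × r ∈ ℓ) 𝓛) (members X)
                    × All (λ ℓ → ∣ ℓ ∩ X ∣ ≤ 2) 𝓛
                    × SecantsDisjointOutside X (secants X 𝓛)

-- Passing the secants as an argument makes Agda evaluate them only once.
secantsDisjointOutside? : ∀ X 𝓢 → Dec (SecantsDisjointOutside X 𝓢)
secantsDisjointOutside? X 𝓢 = Fin.all? (λ p → ¬? (p ∈? X) →-dec length (filter (p ∈?_) 𝓢) ℕ.≤? 1)

freelyContainsᶜ? : ∀ 𝓛 X → Dec (FreelyContainsᶜ 𝓛 X)
freelyContainsᶜ? 𝓛 X =
  AllPairs.allPairs? (λ p r → any? (λ ℓ → p ∈? ℓ ×-dec r ∈? ℓ) 𝓛) (members X)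
  ×-dec All.all? (λ ℓ → ∣ ℓ ∩ X ∣ ℕ.≤? 2) 𝓛
  ×-dec secantsDisjointOutside? X (secants X 𝓛)

module _ {𝓛 : LineSet 15} (cfg : IsConfiguration 15 4 20 3 𝓛) where

  freelyContains : ∀ {X} → FreelyContainsᶜ 𝓛 X → FreelyContains 𝓛 X
  freelyContains {X} (joined , secant≤2 , disjoint) = record { edge-line = unique-line ; free = edges-free }
    where
    unique-line : ∀ e → e ∈℘₂ X → ∃! _≡_ (λ ℓ → ℓ List.∈ 𝓛 × e ⊆ ℓ)
    unique-line e (e⊆X , ∣e∣≡2) with p , r , p≢r , p∈e , r∈e , e⊆ ← two-members ∣e∣≡2
      with allPairs-lookup (Any.map Product.swap) joined (∈-members⁺ (e⊆X p∈e)) (∈-members⁺ (e⊆X r∈e))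
    ... | inj₁ p≡r = contradiction p≡r p≢r
    ... | inj₂ pr with ℓ , ℓ∈ , p∈ℓ , r∈ℓ ← find pr
      = ℓ , (ℓ∈ , ∙∙-⊆ p∈ℓ r∈ℓ ∘ e⊆) , λ {m} (m∈ , e⊆m) →
        linear cfg p r p≢r ℓ m ℓ∈ m∈ p∈ℓ r∈ℓ (e⊆m p∈e) (e⊆m r∈e)

    trace : ∀ {e ℓ} → e ∈℘₂ X → ℓ List.∈ 𝓛 → e ⊆ ℓ → e ≡ ℓ ∩ X
    trace (e⊆X , ∣e∣≡2) ℓ∈ e⊆ℓ = ⊆∧∣≥∣⇒≡ (λ x∈e → x∈p∩q⁺ (e⊆ℓ x∈e , e⊆X x∈e))
      (ℕ.≤-trans (All.lookup secant≤2 ℓ∈) (ℕ.≤-reflexive (sym ∣e∣≡2)))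

    edges-free : ∀ e₁ e₂ ℓ₁ ℓ₂ → e₁ ∈℘₂ X → e₂ ∈℘₂ X → ℓ₁ List.∈ 𝓛 → e₁ ⊆ ℓ₁ → ℓ₂ List.∈ 𝓛 → e₂ ⊆ ℓ₂ →
           Nonempty (ℓ₁ ∩ ℓ₂) → Nonempty (e₁ ∩ e₂)
    edges-free e₁ e₂ ℓ₁ ℓ₂ e₁℘ e₂℘ ℓ₁∈ e₁⊆ ℓ₂∈ e₂⊆ (x , x∈) with x∈₁ , x∈₂ ← x∈p∩q⁻ ℓ₁ ℓ₂ x∈ with x ∈? X
    ... | yes x∈X = x , x∈p∩q⁺ ( subst (x ∈_) (sym (trace e₁℘ ℓ₁∈ e₁⊆)) (x∈p∩q⁺ (x∈₁ , x∈X))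
                              , subst (x ∈_) (sym (trace e₂℘ ℓ₂∈ e₂⊆)) (x∈p∩q⁺ (x∈₂ , x∈X)))
    ... | no  x∉X with ℓ₁ ≟ₛ ℓ₂
    ...   | yes refl = let p , _ , _ , p∈e₁ , _ = two-members (proj₂ e₁℘) in
      p , x∈p∩q⁺ (p∈e₁ , subst (p ∈_) (trans (trace e₁℘ ℓ₁∈ e₁⊆) (sym (trace e₂℘ ℓ₂∈ e₂⊆))) p∈e₁)
    ...   | no ℓ₁≢ℓ₂ = contradiction (disjoint x x∉X) (ℕ.<⇒≱ (unique-⊆⇒length≤ ((ℓ₁≢ℓ₂ ∷ []) ∷ [] ∷ [])
      λ { (here refl)         → secant e₁℘ ℓ₁∈ e₁⊆ x∈₁
        ; (there (here refl)) → secant e₂℘ ℓ₂∈ e₂⊆ x∈₂ }))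
      where
      secant : ∀ {e ℓ} → e ∈℘₂ X → ℓ List.∈ 𝓛 → e ⊆ ℓ → x ∈ ℓ → ℓ List.∈ filter (x ∈?_) (secants X 𝓛)
      secant e℘ ℓ∈ e⊆ x∈ℓ = List.∈-filter⁺ (x ∈?_)
        (List.∈-filter⁺ (λ ℓ → ∣ ℓ ∩ X ∣ ℕ.≟ 2) ℓ∈ (trans (cong ∣_∣ (sym (trace e℘ ℓ∈ e⊆))) (proj₂ e℘))) x∈ℓ

clique : Fin 3 → Subset 15
clique 0F = ⟦ a ⟨ i₁ ⟩ , b ⟨ i₁ ⟩ , c ⟨ i₁ ⟩ ⟧ ∪ ⁅ number (q₂ p₁₂) ⁆ ∪ ⁅ number (q₂ p₁₃) ⁆
clique 1F = ⟦ a ⟨ i₂ ⟩ , b ⟨ i₂ ⟩ , c ⟨ i₂ ⟩ ⟧ ∪ ⁅ number (q₂ p₁₂) ⁆ ∪ ⁅ number (q₂ p₂₃) ⁆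
clique 2F = ⟦ a ⟨ i₃ ⟩ , b ⟨ i₃ ⟩ , c ⟨ i₃ ⟩ ⟧ ∪ ⁅ number (q₂ p₁₃) ⁆ ∪ ⁅ number (q₂ p₂₃) ⁆

system : 𝒯 → 𝒯 → 𝒯 → Fin 17 → LineSet 15
system x y z n = TP (determinedBy (lookup (triples x y z) n))

opaque

  systems-configurations : ∀ x y z → Distinct x y z → ∀ n → IsConfigurationᶜ (system x y z n)
  systems-configurations = decide (dec-∀ λ x → dec-∀ λ y → dec-∀ λ z → distinct? x y z →-dec
    Fin.all? λ n → isConfigurationᶜ? (system x y z n))

  systems-cliques : ∀ x y z → Distinct x y z → ∀ n i → FreelyContainsᶜ (system x y z n) (clique i)
  systems-cliques = decide (dec-∀ λ x → dec-∀ λ y → dec-∀ λ z → distinct? x y z →-dec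
    Fin.all? λ n → Fin.all? λ i → freelyContainsᶜ? (system x y z n) (clique i))

  cliques-distinct : ∀ i j → clique i ≡ clique j → i ≡ j
  cliques-distinct = decide (Fin.all? λ i → Fin.all? λ j → clique i ≟ₛ clique j →-dec i Fin.≟ j)

  cliques-size : ∀ i → ∣ clique i ∣ ≡ 5
  cliques-size = decide (Fin.all? λ i → ∣ clique i ∣ ℕ.≟ 5)

module _ {x y z : 𝒯} (D : Distinct x y z) (n : Fin 17) where

  system-isConfiguration : IsConfiguration 15 4 20 3 (system x y z n)
  system-isConfiguration = isConfiguration (systems-configurations x y z D n)

  system-freelyContains : (FreelyContainsAtLeast 3 GraphsK 5) (system x y z n)
  system-freelyContains = clique , cliques-distinct _ _ ,
    λ i → cliques-size i , freelyContains system-isConfiguration (systems-cliques x y z D n i)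

-- An isomorphism invariant

module _ {n} (N : Vec (Subset n) n) where

  -- In a loopless undirected graph this counts each triangle at `p` twice, once for each order of
  -- its other two vertices; `weight` is thereby scaled by four.
  triangles : Fin n → ℕ
  triangles p = sum λ r → if lookup (lookup N p) r then ∣ lookup N p ∩ lookup N r ∣ else 0

  -- The products correlate the value at a point with the values at its neighbours, so the result
  -- depends on how the values are distributed over the graph.
  weigh : Vec ℕ n → ℕ
  weigh w = sum λ p → lookup w p * (lookup w p + sum λ r → if lookup (lookup N p) r then lookup w r else 0)

-- Passing the neighbourhoods and the weights as vectors makes Agda evaluate them only once.
weight : ∀ {n} → Vec (Subset n) n → ℕ
weight N = weigh N (tabulate (triangles N))

noncollinear : ∀ {n} → LineSet n → Fin n → Subset n
noncollinear 𝓛 p = avoiding (filter (p ∈?_) 𝓛)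
  where
  avoiding : LineSet _ → Subset _
  avoiding 𝓟 = tabulate λ r → not (does (any? (r ∈?_) 𝓟))

-- With t p the number of triangles at p in the graph of non-collinear pairs of points,
-- this is the sum of t p * (t p + Σ t r) over all p, where r runs through the neighbours of p.
invariant : ∀ {n} → LineSet n → ℕ
invariant 𝓛 = weight (tabulate (noncollinear 𝓛))

∣X∣≡sum : ∀ {n} (X : Subset n) → ∣ X ∣ ≡ sum λ p → if lookup X p then 1 else 0
∣X∣≡sum []            = refl
∣X∣≡sum (inside  ∷ X) = cong suc (∣X∣≡sum X)
∣X∣≡sum (outside ∷ X) = ∣X∣≡sum X

module _ {n} (π : Permutation n n) where

  sum-transport : ∀ {f g : Fin n → ℕ} → (∀ p → g (π ⟨$⟩ʳ p) ≡ f p) → sum f ≡ sum g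
  sum-transport {f} {g} g∘π≗f = trans (sum-cong-≗ (λ p → sym (g∘π≗f p))) (sym (sum-permute g π))

  module _ (N N′ : Vec (Subset n) n)
           (N′∘π≗N : ∀ p r → lookup (lookup N′ (π ⟨$⟩ʳ p)) (π ⟨$⟩ʳ r) ≡ lookup (lookup N p) r) where

    triangles-transport : ∀ p → triangles N′ (π ⟨$⟩ʳ p) ≡ triangles N p
    triangles-transport p = sym (sum-transport λ r → cong₂ (if_then_else 0) (N′∘π≗N p r) (common-neighbours r))
      where
      common-neighbours : ∀ r → ∣ lookup N′ (π ⟨$⟩ʳ p) ∩ lookup N′ (π ⟨$⟩ʳ r) ∣ ≡ ∣ lookup N p ∩ lookup N r ∣
      common-neighbours r = trans (∣X∣≡sum (lookup N′ (π ⟨$⟩ʳ p) ∩ lookup N′ (π ⟨$⟩ʳ r)))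
        (trans (sym (sum-transport λ u → cong (if_then 1 else 0) (begin
        lookup (lookup N′ (π ⟨$⟩ʳ p) ∩ lookup N′ (π ⟨$⟩ʳ r)) (π ⟨$⟩ʳ u)
          ≡⟨ Vec.lookup-zipWith _∧_ (π ⟨$⟩ʳ u) (lookup N′ (π ⟨$⟩ʳ p)) (lookup N′ (π ⟨$⟩ʳ r)) ⟩
        lookup (lookup N′ (π ⟨$⟩ʳ p)) (π ⟨$⟩ʳ u) ∧ lookup (lookup N′ (π ⟨$⟩ʳ r)) (π ⟨$⟩ʳ u)
          ≡⟨ cong₂ _∧_ (N′∘π≗N p u) (N′∘π≗N r u) ⟩
        lookup (lookup N p) u ∧ lookup (lookup N r) u
          ≡⟨ Vec.lookup-zipWith _∧_ u (lookup N p) (lookup N r) ⟨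
        lookup (lookup N p ∩ lookup N r) u ∎))) (sym (∣X∣≡sum (lookup N p ∩ lookup N r))))
        where open ≡-Reasoning

    weight-transport : weight N ≡ weight N′
    weight-transport = sum-transport λ p → cong₂ _*_ (weights p) (cong₂ _+_ (weights p)
      (sym (sum-transport λ r → cong₂ (if_then_else 0) (N′∘π≗N p r) (weights r))))
      where
      weights : ∀ p → lookup (tabulate (triangles N′)) (π ⟨$⟩ʳ p) ≡ lookup (tabulate (triangles N)) p
      weights p = trans (Vec.lookup∘tabulate (triangles N′) (π ⟨$⟩ʳ p))
        (trans (triangles-transport p) (sym (Vec.lookup∘tabulate (triangles N) p)))

≅⇒invariant≡ : ∀ {n} {𝓛 𝓜 : LineSet n} → 𝓛 ≅ 𝓜 → invariant 𝓛 ≡ invariant 𝓜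
≅⇒invariant≡ {𝓛 = 𝓛} {𝓜} (π , 𝓛∼𝓜) = weight-transport π (tabulate (noncollinear 𝓛))
    (tabulate (noncollinear 𝓜)) λ p r → begin
  lookup (lookup (tabulate (noncollinear 𝓜)) (π ⟨$⟩ʳ p)) (π ⟨$⟩ʳ r)
    ≡⟨ cong (λ X → lookup X (π ⟨$⟩ʳ r)) (Vec.lookup∘tabulate (noncollinear 𝓜) (π ⟨$⟩ʳ p)) ⟩
  lookup (noncollinear 𝓜 (π ⟨$⟩ʳ p)) (π ⟨$⟩ʳ r)
    ≡⟨ Vec.lookup∘tabulate _ (π ⟨$⟩ʳ r) ⟩
  not (does (any? ((π ⟨$⟩ʳ r) ∈?_) (filter ((π ⟨$⟩ʳ p) ∈?_) 𝓜)))
    ≡⟨ cong not (does-⇔ (mk⇔ (to-𝓛 p r) (to-𝓜 p r))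
         (any? ((π ⟨$⟩ʳ r) ∈?_) (filter ((π ⟨$⟩ʳ p) ∈?_) 𝓜)) (any? (r ∈?_) (filter (p ∈?_) 𝓛))) ⟩
  not (does (any? (r ∈?_) (filter (p ∈?_) 𝓛)))
    ≡⟨ Vec.lookup∘tabulate _ r ⟨
  lookup (noncollinear 𝓛 p) r
    ≡⟨ cong (λ X → lookup X r) (Vec.lookup∘tabulate (noncollinear 𝓛) p) ⟨
  lookup (lookup (tabulate (noncollinear 𝓛)) p) r ∎
  where
  open ≡-Reasoning

  to-𝓜 : ∀ p r → Any (r ∈_) (filter (p ∈?_) 𝓛) → Any ((π ⟨$⟩ʳ r) ∈_) (filter ((π ⟨$⟩ʳ p) ∈?_) 𝓜)
  to-𝓜 p r joined with ℓ , ℓ∈ , r∈ℓ ← find joined with ℓ∈𝓛 , p∈ℓ ← List.∈-filter⁻ (p ∈?_) ℓ∈ =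
    List.lose (List.∈-filter⁺ _ (Equivalence.to 𝓛∼𝓜 (List.∈-map⁺ (image π) ℓ∈𝓛)) (∈-image⁺ π p∈ℓ)) (∈-image⁺ π r∈ℓ)

  to-𝓛 : ∀ p r → Any ((π ⟨$⟩ʳ r) ∈_) (filter ((π ⟨$⟩ʳ p) ∈?_) 𝓜) → Any (r ∈_) (filter (p ∈?_) 𝓛)
  to-𝓛 p r joined with m , m∈ , r∈m ← find joined with m∈𝓜 , p∈m ← List.∈-filter⁻ ((π ⟨$⟩ʳ p) ∈?_) m∈
    with ℓ , ℓ∈𝓛 , refl ← List.∈-map⁻ (image π) (Equivalence.from 𝓛∼𝓜 m∈𝓜) =
    List.lose (List.∈-filter⁺ (p ∈?_) ℓ∈𝓛 (preimage p∈m)) (preimage r∈m)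
    where
    preimage : ∀ {u ℓ} → π ⟨$⟩ʳ u ∈ image π ℓ → u ∈ ℓ
    preimage {ℓ = ℓ} u∈ = subst (_∈ ℓ) (inverseˡ π) (∈-image⁻ π u∈)

-- The orientation of (x, y, z) only decides in which order the invariants of the ninth and the tenth system occur.
invariants : Bool → Vec ℕ 17
invariants even =
  12204 ∷ 9672 ∷ 7428 ∷ 9576 ∷ 7356 ∷ 8868 ∷ 8168 ∷ 8120 ∷
  (if even then 10500 else 8088) ∷ (if even then 8088 else 10500) ∷
  8900 ∷ 10540 ∷ 10460 ∷ 10452 ∷ 8964 ∷ 6084 ∷ 3780 ∷ []

invariants-distinct : ∀ even m n → lookup (invariants even) m ≡ lookup (invariants even) n → m ≡ n
invariants-distinct true  = decide (Fin.all? λ m → Fin.all? λ n →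
  lookup (invariants true) m ℕ.≟ lookup (invariants true) n →-dec m Fin.≟ n)
invariants-distinct false = decide (Fin.all? λ m → Fin.all? λ n →
  lookup (invariants false) m ℕ.≟ lookup (invariants false) n →-dec m Fin.≟ n)

opaque

  -- The condition `y ≡ ρ x` singles out the cyclic shifts of (a, b, c). Conjugation by a
  -- transposition takes `ρ` to `ρ⁻¹`, so for the other orderings `(σ x , σ y , ρ)` and
  -- `(σ x , σ y , ρ⁻¹)` change roles.
  invariant-system : ∀ x y z → Distinct x y z → ∀ n →
                     invariant (system x y z n) ≡ lookup (invariants (does (y ≟ Inverse.to ρ x))) n
  invariant-system = decide (dec-∀ λ x → dec-∀ λ y → dec-∀ λ z → distinct? x y z →-dec
    Fin.all? λ n → invariant (system x y z n) ℕ.≟ lookup (invariants (does (y ≟ Inverse.to ρ x))) n)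

systems-nonisomorphic : ∀ {x y z} → Distinct x y z → ∀ {m n} → system x y z m ≅ system x y z n → m ≡ n
systems-nonisomorphic {x} {y} {z} D {m} {n} m≅n = invariants-distinct _ m n
  (trans (sym (invariant-system x y z D m))
    (trans (≅⇒invariant≡ {𝓛 = system x y z m} {system x y z n} m≅n)
      (invariant-system x y z D n)))

-- The classification

opaque

  three-of-three : ∀ (x y z : 𝒯) → (∀ u → u List.∈ x ∷ y ∷ z ∷ []) → Distinct x y z
  three-of-three = decide (dec-∀ λ x → dec-∀ λ y → dec-∀ λ z →
    dec-∀ (λ u → any? (u ≟_) (x ∷ y ∷ z ∷ [])) →-dec distinct? x y z)

I→Fin : I → Fin 3
I→Fin i₁ = 0F
I→Fin i₂ = 1F
I→Fin i₃ = 2F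

I→Fin-injective : Injective _≡_ _≡_ I→Fin
I→Fin-injective {i₁} {i₁} _ = refl
I→Fin-injective {i₂} {i₂} _ = refl
I→Fin-injective {i₃} {i₃} _ = refl

opaque

  labelled : ∀ {𝓛} → IsConfiguration 15 4 20 3 𝓛 → (FreelyContainsAtLeast 3 GraphsK 5) 𝓛 →
             ∃ λ α → ∃₂ λ β γ → Labelling 𝓛 (systemOf α β γ)
  labelled cfg (X , X-injective , K) = code 1≢2 , code 2≢3 , code 1≢3 , labelling
    where open ThreeK₅s cfg (X ∘ I→Fin) (I→Fin-injective ∘ X-injective) (K ∘ I→Fin)

module _ {x y z : 𝒯} (D : Distinct x y z) {𝓛 : LineSet 15} (cfg : IsConfiguration 15 4 20 3 𝓛) where

  embedded-system : ∀ {n} → Labelling 𝓛 (representative x y z n) → ∃ λ m → Embeds (system x y z m) 𝓛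
  -- Index 15 in `triples` is `(idₚ , idₚ , σ x)`, which absorbs the additional representative.
  embedded-system {zero}  Λ =
    15F , Embeds-trans (embedding (exchange x y z) (exchange-preserves x y z D)) (TP-embeds cfg Λ)
    where pattern 15F = suc (suc (suc (suc (suc (suc 9F)))))
  embedded-system {suc n} Λ = n , TP-embeds cfg Λ

  isomorphic-system : (FreelyContainsAtLeast 3 GraphsK 5) 𝓛 → ∃ λ n → 𝓛 ≅ system x y z n
  isomorphic-system K₅s
    with α , β , γ , Λ ← labelled cfg K₅s
    with k , _ , _ , _ , M ← classification α β γ
    with l , _ , _ , _ , M′ ← reorientation x y z D k
    with n , emb ← embedded-system {l} (relabelling M′ (relabelling M Λ))
    = n , Embeds⇒≅ (distinct (target n)) (ℕ.≤-reflexive (trans (line-count cfg) (sym (line-count (target n))))) emb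
    where
    target = system-isConfiguration D

mainTheorem1 :
    ∀ (x y z : 𝒯) → (x ∷ y ∷ z ∷ []) ∼[ set ] (a ∷ b ∷ c ∷ []) →
    let system : Fin 17 → LineSet 15
        system n = TP (determinedBy (lookup (triples x y z) n))
    in
    (∀ n → IsConfiguration 15 4 20 3 (system n)
         × (FreelyContainsAtLeast 3 GraphsK 5) (system n))
    × (∀ m n → m ≢ n → ¬ (system m ≅ system n))
    × (∀ (𝓛 : LineSet 15) → IsConfiguration 15 4 20 3 𝓛 →
         (FreelyContainsAtLeast 3 GraphsK 5) 𝓛 →
         ∃ λ n → 𝓛 ≅ system n)
mainTheorem1 x y z xyz∼abc =
    (λ n → system-isConfiguration D n , system-freelyContains D n)
  , (λ m n m≢n m≅n → m≢n (systems-nonisomorphic D m≅n))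
  , (λ 𝓛 cfg K → isomorphic-system D cfg K)
  where
  D : Distinct x y z
  D = three-of-three x y z λ u → Equivalence.from xyz∼abc (complete u)
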